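{- Let $n$ be a positive odd integer. Then $$ \sum_{k=0}^{n-1}\frac{(aq;q^2)_k\,(q/a;q^2)_k}{(q^2;q^2)_k^2} \equiv (-1)^{(n-1)/2}q^{(1-n^2)/4}\pmod{(1-aq^n)(a-q^n)}. $$
   Context: $a,q$ are indeterminates. The $q$-shifted factorial is $(y;q)_0=1$ and $(y;q)_m=(1-y)(1-yq)\cdots(1-yq^{m-1})$ for $m\geqslant1$. For rational functions $A,B$ and a polynomial $P$, $A\equiv B\pmod P$ means $A-B=P\cdot C/D$ for polynomials $C,D$ with $D$ coprime to $P$. -}

module Defs where

open import Algebra.Bundles using (CommutativeRing; RawRing; Semiring)
open import Algebra.Structures using (IsCommutativeRing)
import Algebra.Definitions.RawSemiring as RawSemiringDefinitions
open import Data.Empty using (⊥-elim)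
open import Data.Fin.Base using (toℕ)
open import Data.Integer.Base using (ℤ; +_; -[1+_])
open import Data.List.Base using (List; []; _∷_; map)
open import Data.Nat.Base using (ℕ; zero; suc)
open import Data.Product.Base using (_×_; _,_; ∃-syntax)
import Data.Rational.Base as ℚ
import Data.Rational.Properties as ℚ
open import Data.Sum.Base using (_⊎_; inj₁; inj₂)
open import Level using (0ℓ)
open import Relation.Nullary using (¬_; Dec; yes; no)
open import Relation.Binary.PropositionalEquality as ≡ using (_≡_)
import Algebra.Properties.Ring
import Relation.Binary.Reasoning.Setoid as SetoidReasoning

record IntegralDomain : Set₁ where
  field
    commutativeRing : CommutativeRing 0ℓ 0ℓ
  open CommutativeRing commutativeRing public
  field
    ≈0?             : ∀ x → Dec (x ≈ 0#)
    1≉0             : ¬ (1# ≈ 0#)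
    noZeroDivisors  : ∀ x y → x * y ≈ 0# → x ≈ 0# ⊎ y ≈ 0#

module Polynomial (R : CommutativeRing 0ℓ 0ℓ) where

  open CommutativeRing R

  -- c₀ ∷ c₁ ∷ … represents c₀ + c₁X + …; trailing zeros are allowed and
  -- are identified by _≋_.
  Poly : Set
  Poly = List Carrier

  coeff : Poly → ℕ → Carrier
  coeff []      _       = 0#
  coeff (c ∷ p) zero    = c
  coeff (c ∷ p) (suc i) = coeff p i

  infix 4 _≋_
  record _≋_ (p r : Poly) : Set where
    constructor mk≋
    field coeff≈ : ∀ i → coeff p i ≈ coeff r i
  open _≋_ public

  infixl 6 _⊕_
  _⊕_ : Poly → Poly → Poly
  []      ⊕ r       = r
  (c ∷ p) ⊕ []      = c ∷ p
  (c ∷ p) ⊕ (d ∷ r) = (c + d) ∷ (p ⊕ r)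

  ⊖_ : Poly → Poly
  ⊖_ = map (-_)

  infixr 7 _·_
  _·_ : Carrier → Poly → Poly
  c · p = map (c *_) p

  infixl 7 _⊛_
  _⊛_ : Poly → Poly → Poly
  []      ⊛ r = []
  (c ∷ p) ⊛ r = c · r ⊕ (0# ∷ p ⊛ r)

  const : Carrier → Poly
  const c = c ∷ []

  X : Poly
  X = 0# ∷ 1# ∷ []

  private
    open Algebra.Properties.Ring ring using (-0#≈0#)
    module R = SetoidReasoning setoid

    coeff-⊕ : ∀ p r i → coeff (p ⊕ r) i ≈ coeff p i + coeff r i
    coeff-⊕ []      r       i       = sym (+-identityˡ _)
    coeff-⊕ (c ∷ p) []      i       = sym (+-identityʳ _)
    coeff-⊕ (c ∷ p) (d ∷ r) zero    = refl
    coeff-⊕ (c ∷ p) (d ∷ r) (suc i) = coeff-⊕ p r i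

    coeff-⊖ : ∀ p i → coeff (⊖ p) i ≈ - coeff p i
    coeff-⊖ []      i       = sym -0#≈0#
    coeff-⊖ (c ∷ p) zero    = refl
    coeff-⊖ (c ∷ p) (suc i) = coeff-⊖ p i

    coeff-· : ∀ c p i → coeff (c · p) i ≈ c * coeff p i
    coeff-· c []      i       = sym (zeroʳ c)
    coeff-· c (d ∷ p) zero    = refl
    coeff-· c (d ∷ p) (suc i) = coeff-· c p i

    ≋-refl : ∀ {p} → p ≋ p
    ≋-refl = mk≋ λ _ → refl

    ≋-sym : ∀ {p r} → p ≋ r → r ≋ p
    ≋-sym e = mk≋ λ i → sym (coeff≈ e i)

    ≋-trans : ∀ {p r s} → p ≋ r → r ≋ s → p ≋ s
    ≋-trans e f = mk≋ λ i → trans (coeff≈ e i) (coeff≈ f i)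

    ⊕-cong : ∀ {p p′ r r′} → p ≋ p′ → r ≋ r′ → p ⊕ r ≋ p′ ⊕ r′
    ⊕-cong {p} {p′} {r} {r′} e f = mk≋ λ i →
      trans (coeff-⊕ p r i) (trans (+-cong (coeff≈ e i) (coeff≈ f i)) (sym (coeff-⊕ p′ r′ i)))

    ⊕-assoc : ∀ p r s → (p ⊕ r) ⊕ s ≋ p ⊕ (r ⊕ s)
    ⊕-assoc p r s = mk≋ λ i → R.begin
      coeff (p ⊕ r ⊕ s) i                   R.≈⟨ coeff-⊕ (p ⊕ r) s i ⟩
      coeff (p ⊕ r) i + coeff s i           R.≈⟨ +-congʳ (coeff-⊕ p r i) ⟩
      coeff p i + coeff r i + coeff s i     R.≈⟨ +-assoc _ _ _ ⟩
      coeff p i + (coeff r i + coeff s i)   R.≈⟨ +-congˡ (coeff-⊕ r s i) ⟨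
      coeff p i + coeff (r ⊕ s) i           R.≈⟨ coeff-⊕ p (r ⊕ s) i ⟨
      coeff (p ⊕ (r ⊕ s)) i                 R.∎

    ⊕-comm : ∀ p r → p ⊕ r ≋ r ⊕ p
    ⊕-comm p r = mk≋ λ i →
      trans (coeff-⊕ p r i) (trans (+-comm _ _) (sym (coeff-⊕ r p i)))

    ⊕-identityʳ : ∀ p → p ⊕ [] ≋ p
    ⊕-identityʳ p = ⊕-comm p []

    ⊖-cong : ∀ {p r} → p ≋ r → ⊖ p ≋ ⊖ r
    ⊖-cong {p} {r} e = mk≋ λ i →
      trans (coeff-⊖ p i) (trans (-‿cong (coeff≈ e i)) (sym (coeff-⊖ r i)))

    ⊖-inverseʳ : ∀ p → p ⊕ ⊖ p ≋ []
    ⊖-inverseʳ p = mk≋ λ i →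
      trans (coeff-⊕ p (⊖ p) i) (trans (+-congˡ (coeff-⊖ p i)) (-‿inverseʳ _))

    ⊖-inverseˡ : ∀ p → ⊖ p ⊕ p ≋ []
    ⊖-inverseˡ p = ≋-trans (⊕-comm (⊖ p) p) (⊖-inverseʳ p)

    ∷-cong : ∀ {c d p r} → c ≈ d → p ≋ r → c ∷ p ≋ d ∷ r
    ∷-cong e f = mk≋ λ { zero → e ; (suc i) → coeff≈ f i }

    0∷[] : 0# ∷ [] ≋ []
    0∷[] = mk≋ λ { zero → refl ; (suc i) → refl }

    ·-cong : ∀ {c d p r} → c ≈ d → p ≋ r → c · p ≋ d · r
    ·-cong {c} {d} {p} {r} e f = mk≋ λ i →
      trans (coeff-· c p i) (trans (*-cong e (coeff≈ f i)) (sym (coeff-· d r i)))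

    ·-distribʳ : ∀ c d p → (c + d) · p ≋ c · p ⊕ d · p
    ·-distribʳ c d p = mk≋ λ i → R.begin
      coeff ((c + d) · p) i               R.≈⟨ coeff-· (c + d) p i ⟩
      (c + d) * coeff p i                 R.≈⟨ distribʳ _ c d ⟩
      c * coeff p i + d * coeff p i       R.≈⟨ +-cong (coeff-· c p i) (coeff-· d p i) ⟨
      coeff (c · p) i + coeff (d · p) i   R.≈⟨ coeff-⊕ (c · p) (d · p) i ⟨
      coeff (c · p ⊕ d · p) i             R.∎

    ·-distribˡ : ∀ c p r → c · (p ⊕ r) ≋ c · p ⊕ c · r
    ·-distribˡ c p r = mk≋ λ i → R.begin
      coeff (c · (p ⊕ r)) i               R.≈⟨ coeff-· c (p ⊕ r) i ⟩
      c * coeff (p ⊕ r) i                 R.≈⟨ *-congˡ (coeff-⊕ p r i) ⟩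
      c * (coeff p i + coeff r i)         R.≈⟨ distribˡ c _ _ ⟩
      c * coeff p i + c * coeff r i       R.≈⟨ +-cong (coeff-· c p i) (coeff-· c r i) ⟨
      coeff (c · p) i + coeff (c · r) i   R.≈⟨ coeff-⊕ (c · p) (c · r) i ⟨
      coeff (c · p ⊕ c · r) i             R.∎

    ·-assoc : ∀ c d p → (c * d) · p ≋ c · d · p
    ·-assoc c d p = mk≋ λ i → R.begin
      coeff ((c * d) · p) i   R.≈⟨ coeff-· (c * d) p i ⟩
      c * d * coeff p i       R.≈⟨ *-assoc c d _ ⟩
      c * (d * coeff p i)     R.≈⟨ *-congˡ (coeff-· d p i) ⟨
      c * coeff (d · p) i     R.≈⟨ coeff-· c (d · p) i ⟨
      coeff (c · d · p) i     R.∎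

    ·-identity : ∀ p → 1# · p ≋ p
    ·-identity p = mk≋ λ i → trans (coeff-· 1# p i) (*-identityˡ _)

    ·-zero : ∀ p → 0# · p ≋ []
    ·-zero p = mk≋ λ i → trans (coeff-· 0# p i) (zeroˡ _)

    ⊕-interchange : ∀ p r s t → (p ⊕ r) ⊕ (s ⊕ t) ≋ (p ⊕ s) ⊕ (r ⊕ t)
    ⊕-interchange p r s t =
      ≋-trans (⊕-assoc p r (s ⊕ t))
      (≋-trans (⊕-cong (≋-refl {p})
        (≋-trans (≋-sym (⊕-assoc r s t))
        (≋-trans (⊕-cong (⊕-comm r s) (≋-refl {t})) (⊕-assoc s r t))))
      (≋-sym (⊕-assoc p s (r ⊕ t))))

    ⊛-congˡ : ∀ p {r s} → r ≋ s → p ⊛ r ≋ p ⊛ s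
    ⊛-congˡ []      e = ≋-refl
    ⊛-congˡ (c ∷ p) e = ⊕-cong (·-cong refl e) (∷-cong refl (⊛-congˡ p e))

    0∷-⊛ : ∀ p r → (0# ∷ p) ⊛ r ≋ 0# ∷ p ⊛ r
    0∷-⊛ p r = ⊕-cong (·-zero r) (≋-refl {0# ∷ p ⊛ r})

    ⊛-zeroʳ : ∀ p → p ⊛ [] ≋ []
    ⊛-zeroʳ []      = ≋-refl
    ⊛-zeroʳ (c ∷ p) = ≋-trans (∷-cong refl (⊛-zeroʳ p)) 0∷[]

    ⊛-distribʳ : ∀ s p r → (p ⊕ r) ⊛ s ≋ p ⊛ s ⊕ r ⊛ s
    ⊛-distribʳ s []      r       = ≋-refl
    ⊛-distribʳ s (c ∷ p) []      = ≋-sym (⊕-identityʳ _)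
    ⊛-distribʳ s (c ∷ p) (d ∷ r) =
      ≋-trans
        (⊕-cong (·-distribʳ c d s)
          (∷-cong (sym (+-identityˡ 0#)) (⊛-distribʳ s p r)))
        (⊕-interchange (c · s) (d · s) (0# ∷ p ⊛ s) (0# ∷ r ⊛ s))

    ·-⊛ : ∀ c p r → (c · p) ⊛ r ≋ c · (p ⊛ r)
    ·-⊛ c []      r = ≋-refl
    ·-⊛ c (d ∷ p) r =
      ≋-trans
        (⊕-cong (·-assoc c d r) (∷-cong (sym (zeroʳ c)) (·-⊛ c p r)))
        (≋-sym (·-distribˡ c (d · r) (0# ∷ p ⊛ r)))

    ⊛-assoc : ∀ p r s → (p ⊛ r) ⊛ s ≋ p ⊛ (r ⊛ s)
    ⊛-assoc []      r s = ≋-refl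
    ⊛-assoc (c ∷ p) r s =
      ≋-trans (⊛-distribʳ s (c · r) (0# ∷ p ⊛ r))
        (⊕-cong (·-⊛ c r s)
          (≋-trans (0∷-⊛ (p ⊛ r) s) (∷-cong refl (⊛-assoc p r s))))

    ⊛-∷ : ∀ p c r → p ⊛ (c ∷ r) ≋ c · p ⊕ (0# ∷ p ⊛ r)
    ⊛-∷ []      c r = ≋-sym 0∷[]
    ⊛-∷ (d ∷ p) c r =
      ∷-cong (+-congʳ (*-comm d c))
        (≋-trans (⊕-cong (≋-refl {d · r}) (⊛-∷ p c r))
        (≋-trans (≋-sym (⊕-assoc (d · r) (c · p) (0# ∷ p ⊛ r)))
        (≋-trans (⊕-cong (⊕-comm (d · r) (c · p)) (≋-refl {0# ∷ p ⊛ r}))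
                 (⊕-assoc (c · p) (d · r) (0# ∷ p ⊛ r)))))

    ⊛-comm : ∀ p r → p ⊛ r ≋ r ⊛ p
    ⊛-comm []      r = ≋-sym (⊛-zeroʳ r)
    ⊛-comm (c ∷ p) r =
      ≋-trans (⊕-cong (≋-refl {c · r}) (∷-cong refl (⊛-comm p r)))
              (≋-sym (⊛-∷ r c p))

    ⊛-cong : ∀ {p p′ r r′} → p ≋ p′ → r ≋ r′ → p ⊛ r ≋ p′ ⊛ r′
    ⊛-cong {p} {p′} {r} {r′} e f =
      ≋-trans (⊛-congˡ p f)
      (≋-trans (⊛-comm p r′) (≋-trans (⊛-congˡ r′ e) (⊛-comm r′ p′)))

    ⊛-identityˡ : ∀ p → const 1# ⊛ p ≋ p
    ⊛-identityˡ p = ≋-trans (⊕-cong (·-identity p) 0∷[]) (⊕-identityʳ p)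

    ⊛-distribˡ : ∀ s p r → s ⊛ (p ⊕ r) ≋ s ⊛ p ⊕ s ⊛ r
    ⊛-distribˡ s p r =
      ≋-trans (⊛-comm s (p ⊕ r))
      (≋-trans (⊛-distribʳ s p r) (⊕-cong (⊛-comm p s) (⊛-comm r s)))

  ⊛-⊕-isCommutativeRing : IsCommutativeRing _≋_ _⊕_ _⊛_ ⊖_ [] (const 1#)
  ⊛-⊕-isCommutativeRing = record
    { isRing = record
      { +-isAbelianGroup = record
        { isGroup = record
          { isMonoid = record
            { isSemigroup = record
              { isMagma = record
                { isEquivalence = record { refl = ≋-refl ; sym = ≋-sym ; trans = ≋-trans }
                ; ∙-cong = ⊕-cong
                }
              ; assoc = ⊕-assoc
              }
            ; identity = (λ _ → ≋-refl) , ⊕-identityʳ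
            }
          ; inverse = ⊖-inverseˡ , ⊖-inverseʳ
          ; ⁻¹-cong = ⊖-cong
          }
        ; comm = ⊕-comm
        }
      ; *-cong = ⊛-cong
      ; *-assoc = ⊛-assoc
      ; *-identity = ⊛-identityˡ , λ p → ≋-trans (⊛-comm p (const 1#)) (⊛-identityˡ p)
      ; distrib = ⊛-distribˡ , ⊛-distribʳ
      }
    ; *-comm = ⊛-comm
    }

  polynomialRing : CommutativeRing 0ℓ 0ℓ
  polynomialRing = record { isCommutativeRing = ⊛-⊕-isCommutativeRing }

module PolynomialDomain (D : IntegralDomain) where

  open IntegralDomain D
  open Polynomial commutativeRing
  private module P = CommutativeRing polynomialRing

  private
    ∷-zero : ∀ {c p} → c ≈ 0# → p ≋ [] → c ∷ p ≋ []
    ∷-zero e f = mk≋ λ { zero → e ; (suc i) → coeff≈ f i }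

    tail-zero : ∀ {c p} → c ∷ p ≋ [] → p ≋ []
    tail-zero e = mk≋ λ i → coeff≈ e (suc i)

    ≋[]? : ∀ p → Dec (p ≋ [])
    ≋[]? []      = yes P.refl
    ≋[]? (c ∷ p) with ≈0? c | ≋[]? p
    ... | yes c≈0 | yes p≋0 = yes (∷-zero c≈0 p≋0)
    ... | no  c≉0 | _       = no λ e → c≉0 (coeff≈ e 0)
    ... | yes _   | no  p≉0 = no λ e → p≉0 (tail-zero e)

    0∷⊛ : ∀ {c} p r → c ≈ 0# → (c ∷ p) ⊛ r ≋ [] → p ⊛ r ≋ []
    0∷⊛ {c} p r c≈0 e = tail-zero (P.trans (P.sym (P.+-congʳ {0# ∷ p ⊛ r} c·r≋0)) e)
      where
      c·r≋0 : c · r ≋ []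
      c·r≋0 = lemma r
        where
        lemma : ∀ s → c · s ≋ []
        lemma []      = P.refl
        lemma (d ∷ s) = ∷-zero (trans (*-congʳ c≈0) (zeroˡ d)) (lemma s)

    nonzeroHead : ∀ {c} p r → ¬ (c ≈ 0#) → (c ∷ p) ⊛ r ≋ [] → r ≋ []
    nonzeroHead p []      c≉0 e = P.refl
    nonzeroHead {c} p (d ∷ r) c≉0 e
      with noZeroDivisors c d (trans (sym (+-identityʳ _)) (coeff≈ e 0))
    ... | inj₁ c≈0 = ⊥-elim (c≉0 c≈0)
    ... | inj₂ d≈0 = ∷-zero d≈0 (nonzeroHead p r c≉0
            (P.trans (P.*-comm (c ∷ p) r)
              (0∷⊛ r (c ∷ p) d≈0 (P.trans (P.*-comm (d ∷ r) (c ∷ p)) e))))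

    ⊛-noZeroDivisors : ∀ p r → p ⊛ r ≋ [] → p ≋ [] ⊎ r ≋ []
    ⊛-noZeroDivisors []      r e = inj₁ P.refl
    ⊛-noZeroDivisors (c ∷ p) r e with ≈0? c
    ... | no  c≉0 = inj₂ (nonzeroHead p r c≉0 e)
    ... | yes c≈0 with ⊛-noZeroDivisors p r (0∷⊛ p r c≈0 e)
    ...   | inj₁ p≋0 = inj₁ (∷-zero c≈0 p≋0)
    ...   | inj₂ r≋0 = inj₂ r≋0

  polynomialDomain : IntegralDomain
  polynomialDomain = record
    { commutativeRing = polynomialRing
    ; ≈0?             = ≋[]?
    ; 1≉0             = λ e → 1≉0 (coeff≈ e 0)
    ; noZeroDivisors  = ⊛-noZeroDivisors
    }

module FractionField (D : IntegralDomain) where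

  private module D = IntegralDomain D

  record Fraction : Set where
    constructor fraction
    field
      num   : D.Carrier
      den   : D.Carrier
      den≉0 : ¬ (den D.≈ D.0#)
  open Fraction public

  private
    *-≉0 : ∀ {x y} → ¬ (x D.≈ D.0#) → ¬ (y D.≈ D.0#) → ¬ (x D.* y D.≈ D.0#)
    *-≉0 {x} {y} x≉0 y≉0 e with D.noZeroDivisors x y e
    ... | inj₁ x≈0 = x≉0 x≈0
    ... | inj₂ y≈0 = y≉0 y≈0

  infix 4 _≈ᶠ_
  record _≈ᶠ_ (x y : Fraction) : Set where
    constructor mk≈ᶠ
    field cross : num x D.* den y D.≈ num y D.* den x
  open _≈ᶠ_ public

  embed : D.Carrier → Fraction
  embed x = fraction x D.1# D.1≉0

  fractionRawRing : RawRing 0ℓ 0ℓ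
  fractionRawRing = record
    { Carrier = Fraction
    ; _≈_     = _≈ᶠ_
    ; _+_     = λ x y → fraction (num x D.* den y D.+ num y D.* den x)
                                 (den x D.* den y) (*-≉0 (den≉0 x) (den≉0 y))
    ; _*_     = λ x y → fraction (num x D.* num y)
                                 (den x D.* den y) (*-≉0 (den≉0 x) (den≉0 y))
    ; -_      = λ x → fraction (D.- num x) (den x) (den≉0 x)
    ; 0#      = embed D.0#
    ; 1#      = embed D.1#
    }

  -- Total inverse with 0⁻¹ = 0.  The theorem only inverts a, q and
  -- (q²;q²)ₖ², which are nonzero.
  infix 8 _⁻¹
  _⁻¹ : Fraction → Fraction
  x ⁻¹ with D.≈0? (num x)
  ... | yes _     = embed D.0#
  ... | no  num≉0 = fraction (den x) (num x) num≉0

ℚ-domain : IntegralDomain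
ℚ-domain = record
  { commutativeRing = ℚ.+-*-commutativeRing
  ; ≈0?             = ℚ._≟ ℚ.0ℚ
  ; 1≉0             = λ ()
  ; noZeroDivisors  = noZeroDivisors
  }
  where
  noZeroDivisors : ∀ x y → x ℚ.* y ≡ ℚ.0ℚ → x ≡ ℚ.0ℚ ⊎ y ≡ ℚ.0ℚ
  noZeroDivisors x y e with x ℚ.≟ ℚ.0ℚ
  ... | yes x≡0 = inj₁ x≡0
  ... | no  x≢0 = inj₂ (begin
      y                        ≡⟨ ℚ.*-identityˡ y ⟨
      ℚ.1ℚ ℚ.* y               ≡⟨ ≡.cong (ℚ._* y) (ℚ.*-inverseˡ x) ⟨
      ℚ.1/ x ℚ.* x ℚ.* y       ≡⟨ ℚ.*-assoc (ℚ.1/ x) x y ⟩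
      ℚ.1/ x ℚ.* (x ℚ.* y)     ≡⟨ ≡.cong (ℚ.1/ x ℚ.*_) e ⟩
      ℚ.1/ x ℚ.* ℚ.0ℚ          ≡⟨ ℚ.*-zeroʳ (ℚ.1/ x) ⟩
      ℚ.0ℚ                     ∎)
    where
    open ≡.≡-Reasoning
    instance
      x-nonZero : ℚ.NonZero x
      x-nonZero = ℚ.≢-nonZero x≢0

ℚ[q] : IntegralDomain
ℚ[q] = PolynomialDomain.polynomialDomain ℚ-domain

-- ℚ[q][a]: coefficient lists in a whose entries are polynomials in q.
ℚ[a,q] : IntegralDomain
ℚ[a,q] = PolynomialDomain.polynomialDomain ℚ[q]

-- Operations on polynomials carry the superscript ᴾ; the plain symbols
-- are the operations on rational functions.
open IntegralDomain ℚ[a,q] public using ()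
  renaming ( Carrier to ℚ[a,q]-Carrier; _≈_ to _≈ᴾ_; _+_ to _+ᴾ_; _*_ to _*ᴾ_
           ; -_ to -ᴾ_; _-_ to _-ᴾ_; 0# to 0ᴾ; 1# to 1ᴾ; semiring to semiringᴾ )

open RawSemiringDefinitions (Semiring.rawSemiring semiringᴾ) public using ()
  renaming (_^_ to _^ᴾ_; Coprime to Coprimeᴾ)

aᴾ qᴾ : ℚ[a,q]-Carrier
aᴾ = Polynomial.X (IntegralDomain.commutativeRing ℚ[q])
qᴾ = Polynomial.const (IntegralDomain.commutativeRing ℚ[q])
       (Polynomial.X (IntegralDomain.commutativeRing ℚ-domain))

open FractionField ℚ[a,q] public
  using (fraction; num; den; den≉0; mk≈ᶠ; cross; embed; _⁻¹)

ℚ⟨a,q⟩ : RawRing 0ℓ 0ℓ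
ℚ⟨a,q⟩ = FractionField.fractionRawRing ℚ[a,q]

open RawRing ℚ⟨a,q⟩ public using (_≈_; _+_; _*_; -_; 0#; 1#)
  renaming (Carrier to ℚ⟨a,q⟩-Carrier)

open RawSemiringDefinitions (RawRing.rawSemiring ℚ⟨a,q⟩) public using (_^_; sum)

infixl 6 _-_
_-_ : ℚ⟨a,q⟩-Carrier → ℚ⟨a,q⟩-Carrier → ℚ⟨a,q⟩-Carrier
x - y = x + (- y)

infixl 7 _/_
_/_ : ℚ⟨a,q⟩-Carrier → ℚ⟨a,q⟩-Carrier → ℚ⟨a,q⟩-Carrier
x / y = x * y ⁻¹

infixr 8 _^ᶻ_
_^ᶻ_ : ℚ⟨a,q⟩-Carrier → ℤ → ℚ⟨a,q⟩-Carrier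
x ^ᶻ (+ m)    = x ^ m
x ^ᶻ -[1+ m ] = (x ⁻¹) ^ suc m

a q : ℚ⟨a,q⟩-Carrier
a = embed aᴾ
q = embed qᴾ

sum< : ℕ → (ℕ → ℚ⟨a,q⟩-Carrier) → ℚ⟨a,q⟩-Carrier
sum< n f = sum {n} (λ k → f (toℕ k))

infix 5 sum<
syntax sum< n (λ k → t) = ∑[ k < n ] t

-- ⟨ y ⨾ p ⟩ m is (y;p)ₘ.
⟨_⨾_⟩_ : ℚ⟨a,q⟩-Carrier → ℚ⟨a,q⟩-Carrier → ℕ → ℚ⟨a,q⟩-Carrier
⟨ y ⨾ p ⟩ zero  = 1#
⟨ y ⨾ p ⟩ suc m = ⟨ y ⨾ p ⟩ m * (1# - y * p ^ m)

infix 4 _≡_[mod_]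
_≡_[mod_] : ℚ⟨a,q⟩-Carrier → ℚ⟨a,q⟩-Carrier → ℚ[a,q]-Carrier → Set
A ≡ B [mod P ] =
  ∃[ C ] ∃[ D ] ∃[ D≉0 ] Coprimeᴾ D P × A - B ≈ embed P * fraction C D D≉0

{-# OPTIONS --safe #-}
module Submission where

-- Write n = 2N + 1, Q = q² and xᵢ = (1 − aqQⁱ)(1 − (q/a)Qⁱ), so that the
-- modulus is a·x_N and the k-th summand is ∏_{i<k} xᵢ/(1 − Qⁱ⁺¹)².  Each xᵢ
-- depends on a only through a + 1/a, whence
--   xᵢ = (1 − Qⁱ⁻ᴺ)(1 − Qᴺ⁺ⁱ⁺¹) + Qⁱ⁻ᴺ x_N,
-- and modulo x_N the sum becomes the terminating q-Chu–Vandermonde sum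
--   S_N = Σ_k (Q⁻ᴺ;Q)ₖ (Qᴺ⁺¹;Q)ₖ / (Q;Q)ₖ² = (−1)ᴺ Q^(−N(N+1)/2),
-- proved by induction on N because Qᴺ⁺¹ S_{N+1} + S_N telescopes to 0.
-- All denominators that occur are c(q)·aʲ with c ≠ 0.  A common divisor of
-- such a monomial and of −qⁿ + (1 + q²ⁿ)a − qⁿa² is free of a, hence divides
-- qⁿ and 1 + q²ⁿ, hence is a unit.

open import Algebra.Bundles using (CommutativeRing; RawRing; Ring; Semiring)
open import Algebra.Solver.Ring.AlmostCommutativeRing using (fromCommutativeRing; _-Raw-AlmostCommutative⟶_)
import Algebra.Definitions.RawMagma
import Algebra.Definitions.RawSemiring
import Algebra.Properties.Ring
import Algebra.Properties.Semiring.Exp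
import Algebra.Properties.Semiring.Mult.TCOptimised
import Algebra.Solver.Ring
open import Data.Empty using (⊥-elim)
open import Data.Fin.Base using (toℕ)
open import Data.Integer.Base as ℤ using (ℤ; +_; -[1+_]; 1ℤ)
import Data.Integer.DivMod as ℤ
import Data.Integer.Properties as ℤ
open import Data.Integer.Tactic.RingSolver using (solve-∀)
open import Data.List.Base using ([]; _∷_)
open import Data.Maybe.Base using (Maybe; just; nothing)
open import Data.Nat.Base as ℕ using (ℕ; zero; suc; s≤s; _<_; _∸_; _%_)
import Data.Nat.DivMod as ℕ
import Data.Nat.Properties as ℕ
open import Data.Product.Base using (_×_; _,_; ∃-syntax)
open import Data.Sum.Base using (_⊎_; inj₁; inj₂)
open import Level using (0ℓ)
open import Relation.Binary.PropositionalEquality as ≡ using (_≡_; cong; cong₂)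
import Relation.Binary.Reasoning.Setoid
open import Relation.Nullary using (¬_; yes; no)
open import Defs using (IntegralDomain; module Polynomial; module PolynomialDomain; module FractionField)

-- The congruence asks for an explicit cofactor C/D with D coprime to the modulus. The cofactor is
-- therefore never obtained by dividing by x_N: it is built by ring operations from a, q, their
-- inverses and the inverses of 1 - Qⁱ⁺¹, and the shape of its written denominator is followed
-- through a subring predicate. This lets the q-series part run in an arbitrary commutative ring,
-- with inverses given as elements subject to relations such as ab = 1; the ring solver applies
-- there once a multiple of each relation is supplied. Coprime means that common divisors are units.
-- No Bézout identity could show this in general: a denominator may contain 1 - q², which vanishes
-- together with the modulus at a = q = 1. Hence the argument through divisors, by degrees and
-- contents.

-- Integer coefficients for the ring solver

module IntegerCoefficients (R : CommutativeRing 0ℓ 0ℓ) where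

  open CommutativeRing R
  open Algebra.Properties.Ring ring
  open Algebra.Properties.Semiring.Mult.TCOptimised semiring
    renaming (_×_ to _×′_) using (×-homo-+; ×1-homo-*; 1+×)
  open Relation.Binary.Reasoning.Setoid setoid

  fromℤ : ℤ → Carrier
  fromℤ (+ n)    = n ×′ 1#
  fromℤ -[1+ n ] = - (suc n ×′ 1#)

  fromℤ-⊖ : ∀ m n → fromℤ (m ℤ.⊖ n) ≈ m ×′ 1# - n ×′ 1#
  fromℤ-⊖ m       zero    = sym (trans (+-congˡ -0#≈0#) (+-identityʳ _))
  fromℤ-⊖ zero    (suc n) = sym (+-identityˡ _)
  fromℤ-⊖ (suc m) (suc n) = begin
    fromℤ (suc m ℤ.⊖ suc n)                 ≡⟨ ≡.cong fromℤ (ℤ.[1+m]⊖[1+n]≡m⊖n m n) ⟩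
    fromℤ (m ℤ.⊖ n)                         ≈⟨ fromℤ-⊖ m n ⟩
    m ×′ 1# - n ×′ 1#                       ≈⟨ +-congʳ (+-identityˡ _) ⟨
    0# + m ×′ 1# - n ×′ 1#                  ≈⟨ +-congʳ (+-congʳ (-‿inverseʳ 1#)) ⟨
    (1# - 1#) + m ×′ 1# - n ×′ 1#
      ≈⟨ +-congʳ (trans (+-assoc _ _ _) (trans (+-congˡ (+-comm _ _)) (sym (+-assoc _ _ _)))) ⟩
    (1# + m ×′ 1#) - 1# - n ×′ 1#           ≈⟨ +-assoc _ _ _ ⟩
    (1# + m ×′ 1#) + (- 1# - n ×′ 1#)       ≈⟨ +-congˡ (-‿+-comm 1# _) ⟩
    (1# + m ×′ 1#) - (1# + n ×′ 1#)         ≈⟨ +-cong (1+× m 1#) (-‿cong (1+× n 1#)) ⟨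
    suc m ×′ 1# - suc n ×′ 1#               ∎

  fromℤ-neg : ∀ i → fromℤ (ℤ.- i) ≈ - fromℤ i
  fromℤ-neg (+ zero)  = sym -0#≈0#
  fromℤ-neg (+ suc n) = refl
  fromℤ-neg -[1+ n ]  = sym (-‿involutive _)

  fromℤ-+ : ∀ i j → fromℤ (i ℤ.+ j) ≈ fromℤ i + fromℤ j
  fromℤ-+ (+ m)    (+ n)    = ×-homo-+ 1# m n
  fromℤ-+ (+ m)    -[1+ n ] = fromℤ-⊖ m (suc n)
  fromℤ-+ -[1+ m ] (+ n)    = trans (fromℤ-⊖ n (suc m)) (+-comm _ _)
  fromℤ-+ -[1+ m ] -[1+ n ] = begin
    - (suc (suc (m ℕ.+ n)) ×′ 1#)        ≡⟨ ≡.cong (λ k → - (suc k ×′ 1#)) (ℕ.+-suc m n) ⟨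
    - ((suc m ℕ.+ suc n) ×′ 1#)          ≈⟨ -‿cong (×-homo-+ 1# (suc m) (suc n)) ⟩
    - (suc m ×′ 1# + suc n ×′ 1#)        ≈⟨ -‿+-comm _ _ ⟨
    - (suc m ×′ 1#) + - (suc n ×′ 1#)    ∎

  fromℤ-+* : ∀ m j → fromℤ (+ m ℤ.* j) ≈ m ×′ 1# * fromℤ j
  fromℤ-+* m (+ n) = begin
    fromℤ (+ m ℤ.* + n)    ≡⟨ ≡.cong fromℤ (ℤ.pos-* m n) ⟨
    (m ℕ.* n) ×′ 1#        ≈⟨ ×1-homo-* m n ⟩
    m ×′ 1# * n ×′ 1#      ∎
  fromℤ-+* m -[1+ n ] = begin
    fromℤ (+ m ℤ.* -[1+ n ])             ≡⟨ ≡.cong fromℤ (ℤ.neg-distribʳ-* (+ m) (+ suc n)) ⟨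
    fromℤ (ℤ.- (+ m ℤ.* + suc n))        ≈⟨ fromℤ-neg (+ m ℤ.* + suc n) ⟩
    - fromℤ (+ m ℤ.* + suc n)            ≈⟨ -‿cong (fromℤ-+* m (+ suc n)) ⟩
    - (m ×′ 1# * suc n ×′ 1#)            ≈⟨ -‿distribʳ-* _ _ ⟩
    m ×′ 1# * - (suc n ×′ 1#)            ∎

  fromℤ-* : ∀ i j → fromℤ (i ℤ.* j) ≈ fromℤ i * fromℤ j
  fromℤ-* (+ m)    j = fromℤ-+* m j
  fromℤ-* -[1+ m ] j = begin
    fromℤ (-[1+ m ] ℤ.* j)               ≡⟨ ≡.cong fromℤ (ℤ.neg-distribˡ-* (+ suc m) j) ⟨
    fromℤ (ℤ.- (+ suc m ℤ.* j))          ≈⟨ fromℤ-neg (+ suc m ℤ.* j) ⟩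
    - fromℤ (+ suc m ℤ.* j)              ≈⟨ -‿cong (fromℤ-+* (suc m) j) ⟩
    - (suc m ×′ 1# * fromℤ j)            ≈⟨ -‿distribˡ-* _ _ ⟩
    - (suc m ×′ 1#) * fromℤ j            ∎

  fromℤ-morphism : ℤ.+-*-rawRing -Raw-AlmostCommutative⟶ fromCommutativeRing R
  fromℤ-morphism = record
    { ⟦_⟧    = fromℤ
    ; +-homo = fromℤ-+
    ; *-homo = fromℤ-*
    ; -‿homo = fromℤ-neg
    ; 0-homo = refl
    ; 1-homo = refl
    }

  -- Only a positive answer carries over from ℤ: distinct integers may coincide in `R`, so the other
  -- case is `nothing` and not a refutation.
  fromℤ-≟ : ∀ i j → Maybe (fromℤ i ≈ fromℤ j)
  fromℤ-≟ i j with i ℤ.≟ j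
  ... | yes i≡j = just (reflexive (≡.cong fromℤ i≡j))
  ... | no  _   = nothing

  open Algebra.Solver.Ring ℤ.+-*-rawRing (fromCommutativeRing R) fromℤ-morphism fromℤ-≟ public
    using (solve; _:=_; _:+_; _:*_; _:-_; :-_; con)

-- Stated over any raw ring so that the abstract argument can use it; `⟨⨾⟩-agree` matches it with
-- the version in the theorem.
module QShiftedFactorial (R : RawRing 0ℓ 0ℓ) where

  open RawRing R
  open Algebra.Definitions.RawSemiring rawSemiring using (_^_)

  ⟨_⨾_⟩ : Carrier → Carrier → ℕ → Carrier
  ⟨ y ⨾ p ⟩ zero    = 1#
  ⟨ y ⨾ p ⟩ (suc m) = ⟨ y ⨾ p ⟩ m * (1# + - (y * p ^ m))

-- The intended predicate, a written denominator of the form c(q)·aʲ, depends on the representative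
-- of a fraction. Respecting `_≈_` is therefore not among the fields.
record IsSubring (R : CommutativeRing 0ℓ 0ℓ)
                 (Member : CommutativeRing.Carrier R → Set) : Set where
  open CommutativeRing R
  field
    +-closed : ∀ {x y} → Member x → Member y → Member (x + y)
    *-closed : ∀ {x y} → Member x → Member y → Member (x * y)
    -‿closed : ∀ {x} → Member x → Member (- x)
    0-closed : Member 0#
    1-closed : Member 1#

-- Finite sums and powers in a commutative ring

module QSeries (R : CommutativeRing 0ℓ 0ℓ) where

  open CommutativeRing R
  open Algebra.Properties.Semiring.Exp semiring
  open Algebra.Definitions.RawSemiring (Semiring.rawSemiring semiring) using (sum)
  open IntegerCoefficients R
  open Relation.Binary.Reasoning.Setoid setoid

  -- Solver identities hold only modulo a relation x ≈ 1; k is the cofactor.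
  ≈1-elim : ∀ {x y z} k → x ≈ 1# → z ≈ y + (x - 1#) * k → z ≈ y
  ≈1-elim {x} {y} {z} k x≈1 e = begin
    z                     ≈⟨ e ⟩
    y + (x - 1#) * k      ≈⟨ +-congˡ (*-congʳ (+-congʳ x≈1)) ⟩
    y + (1# - 1#) * k     ≈⟨ solve 2 (λ y k → y :+ (con (+ 1) :- con (+ 1)) :* k := y) refl y k ⟩
    y                     ∎

  ^-inverse : ∀ {x y} → x * y ≈ 1# → ∀ n → x ^ n * y ^ n ≈ 1#
  ^-inverse xy≈1 zero = *-identityˡ 1#
  ^-inverse {x} {y} xy≈1 (suc n) = begin
    (x * x ^ n) * (y * y ^ n)
      ≈⟨ solve 4 (λ x y s t → (x :* s) :* (y :* t) := (x :* y) :* (s :* t)) refl x y (x ^ n) (y ^ n) ⟩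
    (x * y) * (x ^ n * y ^ n)   ≈⟨ *-cong xy≈1 (^-inverse xy≈1 n) ⟩
    1# * 1#                     ≈⟨ *-identityˡ 1# ⟩
    1#                          ∎

  -- Splits off the last summand, in step with inductions on the upper limit such as the
  -- telescoping; the library's `sum` splits off the first.
  Σ< : ℕ → (ℕ → Carrier) → Carrier
  Σ< zero    f = 0#
  Σ< (suc n) f = Σ< n f + f n

  Σ<-cong : ∀ n {f g} → (∀ k → f k ≈ g k) → Σ< n f ≈ Σ< n g
  Σ<-cong zero    e = refl
  Σ<-cong (suc n) e = +-cong (Σ<-cong n e) (e n)

  Σ<-head : ∀ n f → Σ< (suc n) f ≈ f 0 + Σ< n (λ k → f (suc k))
  Σ<-head zero    f = +-comm _ _
  Σ<-head (suc n) f = trans (+-congʳ (Σ<-head n f)) (+-assoc _ _ _)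

  sum≈Σ< : ∀ n f → sum {n} (λ k → f (toℕ k)) ≈ Σ< n f
  sum≈Σ< zero    f = refl
  sum≈Σ< (suc n) f = trans (+-congˡ (sum≈Σ< n (λ k → f (suc k)))) (sym (Σ<-head n f))

  open QShiftedFactorial (Ring.rawRing ring) public

  -- The terminating q-Chu-Vandermonde sum

  module ChuVandermonde
    (Q P : Carrier) (QP≈1 : Q * P ≈ 1#)
    (e : ℕ → Carrier) (e-inverse : ∀ i → e i * (1# - Q * Q ^ i) ≈ 1#) where

    -- α N i = 1 − Qⁱ⁻ᴺ and β N i = 1 − Qᴺ⁺ⁱ, with P standing for Q⁻¹.
    α β : ℕ → ℕ → Carrier
    α N i = 1# - Q ^ i * P ^ N
    β N i = 1# - Q ^ N * Q ^ i

    -- The summand (Q⁻ᴺ;Q)ₖ (Qᴺ⁺¹;Q)ₖ / (Q;Q)ₖ² of S_N, with `e i` standing for 1/(1 - Qⁱ⁺¹).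
    t : ℕ → ℕ → Carrier
    t N zero    = 1#
    t N (suc k) = t N k * (α N k * β N (suc k) * (e k * e k))

    -- For N ≥ 1, (1 + Qᴺ) V N k is the sum of Qᴺ t N i + t (N − 1) i over i ≤ k.
    V : ℕ → ℕ → Carrier
    V N zero    = 1#
    V N (suc k) = V N k * (α N (suc k) * β N (suc k) * (e k * e k))

    α-shift : ∀ N i → α N i ≈ α (suc N) (suc i)
    α-shift N i = sym (≈1-elim (- (Q ^ i * P ^ N)) QP≈1
      (solve 4 (λ Q P s t → con (+ 1) :- (Q :* s) :* (P :* t)
                          := con (+ 1) :- s :* t :+ (Q :* P :- con (+ 1)) :* (:- (s :* t)))
        refl Q P (Q ^ i) (P ^ N)))

    β-shift : ∀ N i → β N (suc i) ≈ β (suc N) i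
    β-shift N i = solve 3 (λ Q s t → con (+ 1) :- s :* (Q :* t) := con (+ 1) :- (Q :* s) :* t)
      refl Q (Q ^ N) (Q ^ i)

    -- By the two shifts the factors on the left are `α (suc N) (suc i)` and `β (suc N) i` for i ≤
    -- j. Those of `V (suc N) j` have index `suc i`, i < j, in both families, so the last α and the
    -- first β are left over. With `t-V₀` this puts both summands of `t-step` over the same
    -- `V (suc N) j`.
    t-V : ∀ N j → t N (suc j) ≈ V (suc N) j * (α (suc N) (suc j) * β (suc N) 0 * (e j * e j))
    t-V N zero = *-congˡ (*-congʳ (*-cong (α-shift N 0) (β-shift N 0)))
    t-V N (suc j) = begin
      t N (suc j) * (α N (suc j) * β N (suc (suc j)) * (e (suc j) * e (suc j)))
        ≈⟨ *-cong (t-V N j) (*-congʳ (*-cong (α-shift N (suc j)) (β-shift N (suc j)))) ⟩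
      V (suc N) j * (α (suc N) (suc j) * β (suc N) 0 * (e j * e j))
        * (α (suc N) (suc (suc j)) * β (suc N) (suc j) * (e (suc j) * e (suc j)))
        ≈⟨ solve 7 (λ v a b c d e f →
             v :* (a :* b :* e) :* (c :* d :* f) := v :* (a :* d :* e) :* (c :* b :* f))
           refl (V (suc N) j) (α (suc N) (suc j)) (β (suc N) 0) (α (suc N) (suc (suc j)))
           (β (suc N) (suc j)) (e j * e j) (e (suc j) * e (suc j)) ⟩
      V (suc N) (suc j) * (α (suc N) (suc (suc j)) * β (suc N) 0 * (e (suc j) * e (suc j))) ∎

    t-V₀ : ∀ N j → t N (suc j) ≈ V N j * (α N 0 * β N (suc j) * (e j * e j))
    t-V₀ N zero = refl
    t-V₀ N (suc j) = begin
      t N (suc j) * (α N (suc j) * β N (suc (suc j)) * (e (suc j) * e (suc j)))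
        ≈⟨ *-congʳ (t-V₀ N j) ⟩
      V N j * (α N 0 * β N (suc j) * (e j * e j))
        * (α N (suc j) * β N (suc (suc j)) * (e (suc j) * e (suc j)))
        ≈⟨ solve 7 (λ v a b c d e f →
             v :* (a :* b :* e) :* (c :* d :* f) := v :* (c :* b :* e) :* (a :* d :* f))
           refl (V N j) (α N 0) (β N (suc j)) (α N (suc j))
           (β N (suc (suc j))) (e j * e j) (e (suc j) * e (suc j)) ⟩
      V N (suc j) * (α N 0 * β N (suc (suc j)) * (e (suc j) * e (suc j))) ∎

    -- Gives `V N j` the factor `e j * e j` that the other terms of `t-step` carry, which turns that
    -- step into a polynomial identity.
    V-step : ∀ N j → V N j ≈ V N j * ((1# - Q ^ suc j) * (1# - Q ^ suc j) * (e j * e j))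
    V-step N j = sym (begin
      V N j * (s * s * (e j * e j))
        ≈⟨ solve 3 (λ v s e → v :* (s :* s :* (e :* e)) := v :* ((e :* s) :* (e :* s))) refl (V N j) s (e j) ⟩
      V N j * ((e j * s) * (e j * s))       ≈⟨ *-congˡ (*-cong (e-inverse j) (e-inverse j)) ⟩
      V N j * (1# * 1#)
        ≈⟨ solve 1 (λ v → v :* (con (+ 1) :* con (+ 1)) := v) refl (V N j) ⟩
      V N j                                 ∎)
      where s = 1# - Q ^ suc j

    t-step : ∀ N j → Q ^ suc N * t (suc N) (suc j) + t N (suc j)
                   ≈ (1# + Q ^ suc N) * (V (suc N) (suc j) - V (suc N) j)
    t-step N j = begin
      u * t (suc N) (suc j) + t N (suc j)
        ≈⟨ +-cong (*-congˡ (t-V₀ (suc N) j)) (t-V N j) ⟩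
      u * (W * ((1# - 1# * v) * (1# - u * w) * E)) + W * ((1# - w * v) * (1# - u * 1#) * E)
        -- For v = 1/u both sides equal -(1 + u)(1 - u)² w W E / u. The cofactor is their difference
        -- divided by uv - 1.
        ≈⟨ ≈1-elim (W * E * (u * w + w + w - 1# - w * w - u * (w * w))) (^-inverse QP≈1 (suc N))
           (solve 5 (λ W u v w E → let I = con (+ 1) in
               u :* (W :* ((I :- I :* v) :* (I :- u :* w) :* E)) :+ W :* ((I :- w :* v) :* (I :- u :* I) :* E)
            := (I :+ u) :* (W :* ((I :- w :* v) :* (I :- u :* w) :* E) :- W :* ((I :- w) :* (I :- w) :* E))
               :+ (u :* v :- I) :* (W :* E :* (u :* w :+ w :+ w :- I :- w :* w :- u :* (w :* w))))
            refl W u v w E) ⟩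
      (1# + u) * (W * ((1# - w * v) * (1# - u * w) * E) - W * ((1# - w) * (1# - w) * E))
        ≈⟨ *-congˡ (+-congˡ (-‿cong (V-step (suc N) j))) ⟨
      (1# + u) * (V (suc N) (suc j) - V (suc N) j) ∎
      where
      u = Q ^ suc N
      v = P ^ suc N
      w = Q ^ suc j
      W = V (suc N) j
      E = e j * e j

    t-telescope : ∀ N M → Q ^ suc N * Σ< (suc M) (t (suc N)) + Σ< (suc M) (t N)
                        ≈ (1# + Q ^ suc N) * V (suc N) M
    t-telescope N zero = solve 1 (λ u → let I = con (+ 1) in
        u :* (con (+ 0) :+ I) :+ (con (+ 0) :+ I) := (I :+ u) :* I) refl (Q ^ suc N)
    t-telescope N (suc M) = begin
      u * (S′ + t′) + (S + t₀)
        ≈⟨ solve 5 (λ u s′ t′ s t → u :* (s′ :+ t′) :+ (s :+ t) := (u :* s′ :+ s) :+ (u :* t′ :+ t))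
            refl u S′ t′ S t₀ ⟩
      (u * S′ + S) + (u * t′ + t₀)   ≈⟨ +-cong (t-telescope N M) (t-step N M) ⟩
      (1# + u) * V (suc N) M + (1# + u) * (V (suc N) (suc M) - V (suc N) M)
        ≈⟨ solve 3 (λ u v w → u :* v :+ u :* (w :- v) := u :* w)
            refl (1# + u) (V (suc N) M) (V (suc N) (suc M)) ⟩
      (1# + u) * V (suc N) (suc M)   ∎
      where
      u = Q ^ suc N
      S′ = Σ< (suc M) (t (suc N))
      t′ = t (suc N) (suc M)
      S = Σ< (suc M) (t N)
      t₀ = t N (suc M)

    α-diag : ∀ N → α N N ≈ 0#
    α-diag N = trans (+-congˡ (-‿cong (^-inverse QP≈1 N))) (-‿inverseʳ 1#)

    -- The factor `α (suc N) (suc N)` = 1 - Q⁰ enters at index `suc N` and persists in every later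
    -- product.
    V-vanishes : ∀ N d → V (suc N) (d ℕ.+ suc N) ≈ 0#
    V-vanishes N zero = begin
      V (suc N) N * (α (suc N) (suc N) * b * E)  ≈⟨ *-congˡ (*-congʳ (*-congʳ (α-diag (suc N)))) ⟩
      V (suc N) N * (0# * b * E)
        ≈⟨ solve 3 (λ v b e → v :* (con (+ 0) :* b :* e) := con (+ 0)) refl (V (suc N) N) b E ⟩
      0#                                         ∎
      where
      b = β (suc N) (suc N)
      E = e N * e N
    V-vanishes N (suc d) = trans (*-congʳ (V-vanishes N d)) (zeroˡ _)

    t₀-vanishes : ∀ k → t 0 (suc k) ≈ 0#
    t₀-vanishes zero = begin
      1# * (α 0 0 * β 0 1 * (e 0 * e 0))  ≈⟨ *-congˡ (*-congʳ (*-congʳ (α-diag 0))) ⟩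
      1# * (0# * β 0 1 * (e 0 * e 0))
        ≈⟨ solve 2 (λ b e → con (+ 1) :* (con (+ 0) :* b :* e) := con (+ 0)) refl (β 0 1) (e 0 * e 0) ⟩
      0#                                  ∎
    t₀-vanishes (suc k) = trans (*-congʳ (t₀-vanishes k)) (zeroˡ _)

    chuVandermonde₀ : ∀ M → Σ< (suc M) (t 0) ≈ 1#
    chuVandermonde₀ zero    = +-identityˡ 1#
    chuVandermonde₀ (suc M) = trans (+-cong (chuVandermonde₀ M) (t₀-vanishes M)) (+-identityʳ 1#)

    value : ℕ → Carrier
    value zero    = 1#
    value (suc N) = - (P ^ suc N * value N)

    -- The slack `d` makes the induction possible: telescoping sums `t (suc N)` and `t N` over the
    -- same range, which is one longer than needed for N, so the hypothesis is used at `suc d`.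
    chuVandermonde : ∀ N d → Σ< (suc (d ℕ.+ N)) (t N) ≈ value N
    chuVandermonde zero    d = chuVandermonde₀ (d ℕ.+ 0)
    chuVandermonde (suc N) d = begin
      -- Since v = 1/u, the relation u S′ + S = 0 can be solved for S′.
      S′                            ≈⟨ ≈1-elim (- S′) (^-inverse QP≈1 (suc N))
                                       (solve 4 (λ u v s′ s → s′ := v :* (u :* s′ :+ s) :- v :* s :+ (u :* v :- con (+ 1)) :* (:- s′))
                                         refl u v S′ S) ⟩
      v * (u * S′ + S) - v * S
        ≈⟨ +-cong (*-congˡ (trans (t-telescope N (d ℕ.+ suc N)) (trans (*-congˡ (V-vanishes N d)) (zeroʳ _))))
                                              (-‿cong (*-congˡ S≈)) ⟩
      v * 0# - v * value N
        ≈⟨ solve 2 (λ v r → v :* con (+ 0) :- v :* r := :- (v :* r)) refl v (value N) ⟩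
      - (v * value N)               ∎
      where
      u = Q ^ suc N
      v = P ^ suc N
      S′ = Σ< (suc (d ℕ.+ suc N)) (t (suc N))
      S = Σ< (suc (d ℕ.+ suc N)) (t N)
      S≈ : S ≈ value N
      S≈ = trans (reflexive (≡.cong (λ m → Σ< (suc m) (t N)) (ℕ.+-suc d N))) (chuVandermonde N (suc d))

  -- The congruence, with a cofactor in a given subring

  module CongruenceInSubring
    (a b q p : Carrier) (ab≈1 : a * b ≈ 1#) (qp≈1 : q * p ≈ 1#)
    (e : ℕ → Carrier) (e-inverse : ∀ i → e i * (1# - q ^ 2 * (q ^ 2) ^ i) ≈ 1#)
    (Member : Carrier → Set) (isSubring : IsSubring R Member)
    (a∈ : Member a) (b∈ : Member b) (q∈ : Member q) (p∈ : Member p) (e∈ : ∀ i → Member (e i))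
    where

    open IsSubring isSubring

    Q P : Carrier
    Q = q ^ 2
    P = p ^ 2

    open ChuVandermonde Q P (^-inverse qp≈1 2) e e-inverse

    -- As `P` is p², the exponent N(N+1)/2 of `P` doubles to N(N+1) for `p`, and no halving occurs.
    value≈ : ∀ N → value N ≈ (- 1#) ^ N * p ^ (N ℕ.* suc N)
    value≈ zero = sym (*-identityˡ 1#)
    value≈ (suc N) = begin
      - (P ^ suc N * value N)
        ≈⟨ -‿cong (*-cong (^-assocʳ p 2 (suc N)) (value≈ N)) ⟩
      - (p ^ (2 ℕ.* suc N) * ((- 1#) ^ N * p ^ (N ℕ.* suc N)))
        ≈⟨ solve 3 (λ x s y → :- (x :* (s :* y)) := :- (con (+ 1)) :* s :* (x :* y)) refl
             (p ^ (2 ℕ.* suc N)) ((- 1#) ^ N) (p ^ (N ℕ.* suc N)) ⟩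
      (- 1#) ^ suc N * (p ^ (2 ℕ.* suc N) * p ^ (N ℕ.* suc N))
        ≈⟨ *-congˡ (^-homo-* p (2 ℕ.* suc N) (N ℕ.* suc N)) ⟨
      (- 1#) ^ suc N * p ^ (2 ℕ.* suc N ℕ.+ N ℕ.* suc N)
        ≡⟨ ≡.cong (λ m → (- 1#) ^ suc N * p ^ m)
             (≡.trans (≡.sym (ℕ.*-distribʳ-+ (suc N) 2 N)) (ℕ.*-comm (2 ℕ.+ N) (suc N))) ⟩
      (- 1#) ^ suc N * p ^ (suc N ℕ.* suc (suc N)) ∎

    x : ℕ → Carrier
    x i = (1# - a * q * Q ^ i) * (1# - q * b * Q ^ i)

    -- Both sides have coefficient -qQⁱ at a + 1/a. The part free of a is found at a = qⁿ with n =
    -- 2N + 1: there x_N vanishes, and the two factors of xᵢ become 1 - Qᴺ⁺ⁱ⁺¹ and 1 - Qⁱ⁻ᴺ.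
    xᵢ-reduction : ∀ N i → x i - α N i * β N (suc i) ≈ x N * (Q ^ i * P ^ N)
    xᵢ-reduction N i =
      ≈1-elim (q * q * A * A - q * q * B * A * (B * C)) ab≈1
      (≈1-elim ((a + b) * q * A - q * q * A * A - q * q * B * A) (^-inverse (^-inverse qp≈1 2) N)
      (solve 6 (λ a b q A B C → let I = con (+ 1) ; Q = q :* (q :* I) in
            (I :- a :* q :* A) :* (I :- q :* b :* A) :- (I :- A :* C) :* (I :- B :* (Q :* A))
         := (I :- a :* q :* B) :* (I :- q :* b :* B) :* (A :* C)
            :+ (a :* b :- I) :* (q :* q :* A :* A :- q :* q :* B :* A :* (B :* C))
            :+ (B :* C :- I) :* ((a :+ b) :* q :* A :- q :* q :* A :* A :- q :* q :* B :* A))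
        refl a b q A B C))
      where
      A = Q ^ i
      B = Q ^ N
      C = P ^ N

    T : ℕ → Carrier
    T zero    = 1#
    T (suc k) = T k * (x k * (e k * e k))

    -- The quotient of `T k - t N k` by `x N`, obtained without division from the product rule Tx -
    -- ty = (T - t)x + t(x - y); hence `g∈`.
    g : ℕ → ℕ → Carrier
    g N zero    = 0#
    g N (suc k) = (g N k * x k + t N k * (Q ^ k * P ^ N)) * (e k * e k)

    T-reduction : ∀ N k → T k - t N k ≈ x N * g N k
    T-reduction N zero = trans (-‿inverseʳ 1#) (sym (zeroʳ _))
    T-reduction N (suc k) = begin
      T k * (x k * E) - t N k * (y * E)
        ≈⟨ solve 5 (λ T t x y E → T :* (x :* E) :- t :* (y :* E)
                               := ((T :- t) :* x :+ t :* (x :- y)) :* E) refl (T k) (t N k) (x k) y E ⟩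
      ((T k - t N k) * x k + t N k * (x k - y)) * E
        ≈⟨ *-congʳ (+-cong (*-congʳ (T-reduction N k)) (*-congˡ (xᵢ-reduction N k))) ⟩
      (x N * g N k * x k + t N k * (x N * (Q ^ k * P ^ N))) * E
        ≈⟨ solve 6 (λ m g x t h E → (m :* g :* x :+ t :* (m :* h)) :* E
                                 := m :* ((g :* x :+ t :* h) :* E)) refl
             (x N) (g N k) (x k) (t N k) (Q ^ k * P ^ N) E ⟩
      x N * g N (suc k) ∎
      where
      E = e k * e k
      y = α N k * β N (suc k)

    ΣT-reduction : ∀ N n → Σ< n T - Σ< n (t N) ≈ x N * Σ< n (g N)
    ΣT-reduction N zero = trans (-‿inverseʳ 0#) (sym (zeroʳ _))
    ΣT-reduction N (suc n) = begin
      (Σ< n T + T n) - (Σ< n (t N) + t N n)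
        ≈⟨ solve 4 (λ S T s t → (S :+ T) :- (s :+ t) := (S :- s) :+ (T :- t))
            refl (Σ< n T) (T n) (Σ< n (t N)) (t N n) ⟩
      (Σ< n T - Σ< n (t N)) + (T n - t N n)   ≈⟨ +-cong (ΣT-reduction N n) (T-reduction N n) ⟩
      x N * Σ< n (g N) + x N * g N n          ≈⟨ distribˡ _ _ _ ⟨
      x N * (Σ< n (g N) + g N n)              ∎

    E : ℕ → Carrier
    E zero    = 1#
    E (suc k) = E k * e k

    E-inverse : ∀ k → ⟨ Q ⨾ Q ⟩ k * E k ≈ 1#
    E-inverse zero    = *-identityˡ 1#
    E-inverse (suc k) = begin
      ⟨ Q ⨾ Q ⟩ k * s * (E k * e k)
        ≈⟨ solve 4 (λ c s E e → c :* s :* (E :* e) := (c :* E) :* (e :* s)) refl (⟨ Q ⨾ Q ⟩ k) s (E k) (e k) ⟩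
      (⟨ Q ⨾ Q ⟩ k * E k) * (e k * s)   ≈⟨ *-cong (E-inverse k) (e-inverse k) ⟩
      1# * 1#                           ≈⟨ *-identityˡ 1# ⟩
      1#                                ∎
      where s = 1# - Q * Q ^ k

    term : ℕ → Carrier
    term k = ⟨ a * q ⨾ Q ⟩ k * ⟨ q * b ⨾ Q ⟩ k * E k ^ 2

    term≈T : ∀ k → term k ≈ T k
    term≈T zero = solve 0 (let I = con (+ 1) in I :* I :* (I :* (I :* I)) := I) refl
    term≈T (suc k) = begin
      A * r * (B * s) * ((E k * e k) * ((E k * e k) * 1#))
        ≈⟨ solve 6 (λ A r B s E e → let I = con (+ 1) in
              A :* r :* (B :* s) :* ((E :* e) :* ((E :* e) :* I))
           := A :* B :* (E :* (E :* I)) :* (r :* s :* (e :* e))) refl A r B s (E k) (e k) ⟩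
      term k * (r * s * (e k * e k))   ≈⟨ *-congʳ (term≈T k) ⟩
      T k * (x k * (e k * e k))        ∎
      where
      A = ⟨ a * q ⨾ Q ⟩ k
      B = ⟨ q * b ⨾ Q ⟩ k
      r = 1# - a * q * Q ^ k
      s = 1# - q * b * Q ^ k

    ^-closed : ∀ {y} → Member y → ∀ n → Member (y ^ n)
    ^-closed y∈ zero    = 1-closed
    ^-closed y∈ (suc n) = *-closed y∈ (^-closed y∈ n)

    1-‿closed : ∀ {y} → Member y → Member (1# - y)
    1-‿closed y∈ = +-closed 1-closed (-‿closed y∈)

    Q^∈ : ∀ i → Member (Q ^ i)
    Q^∈ = ^-closed (^-closed q∈ 2)

    P^∈ : ∀ i → Member (P ^ i)
    P^∈ = ^-closed (^-closed p∈ 2)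

    e²∈ : ∀ i → Member (e i * e i)
    e²∈ i = *-closed (e∈ i) (e∈ i)

    x∈ : ∀ i → Member (x i)
    x∈ i = *-closed (1-‿closed (*-closed (*-closed a∈ q∈) (Q^∈ i)))
                    (1-‿closed (*-closed (*-closed q∈ b∈) (Q^∈ i)))

    t∈ : ∀ N k → Member (t N k)
    t∈ N zero    = 1-closed
    t∈ N (suc k) = *-closed (t∈ N k)
      (*-closed (*-closed (1-‿closed (*-closed (Q^∈ k) (P^∈ N)))
                          (1-‿closed (*-closed (Q^∈ N) (Q^∈ (suc k))))) (e²∈ k))

    g∈ : ∀ N k → Member (g N k)
    g∈ N zero    = 0-closed
    g∈ N (suc k) = *-closed (+-closed (*-closed (g∈ N k) (x∈ k))
                                      (*-closed (t∈ N k) (*-closed (Q^∈ k) (P^∈ N)))) (e²∈ k)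

    Σ<-closed : ∀ n {f} → (∀ k → Member (f k)) → Member (Σ< n f)
    Σ<-closed zero    f∈ = 0-closed
    Σ<-closed (suc n) f∈ = +-closed (Σ<-closed n f∈) (f∈ n)

    x≈modulus : ∀ N → x N ≈ (1# - a * q ^ suc (N ℕ.+ N)) * (a - q ^ suc (N ℕ.+ N)) * b
    x≈modulus N = sym (≈1-elim (1# - a * q * Q ^ N) ab≈1 (begin
      (1# - a * (q * q ^ (N ℕ.+ N))) * (a - q * q ^ (N ℕ.+ N)) * b
        ≈⟨ *-congʳ (*-cong (+-congˡ (-‿cong (*-congˡ (*-congˡ q^2N)))) (+-congˡ (-‿cong (*-congˡ q^2N)))) ⟩
      (1# - a * (q * Q ^ N)) * (a - q * Q ^ N) * b
        ≈⟨ solve 4 (λ a b q B → let I = con (+ 1) in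
             (I :- a :* (q :* B)) :* (a :- q :* B) :* b
          := (I :- a :* q :* B) :* (I :- q :* b :* B) :+ (a :* b :- I) :* (I :- a :* q :* B))
              refl a b q (Q ^ N) ⟩
      x N + (a * b - 1#) * (1# - a * q * Q ^ N) ∎))
      where
      q^2N : q ^ (N ℕ.+ N) ≈ Q ^ N
      q^2N = sym (trans (^-assocʳ q 2 N) (reflexive (≡.cong (λ m → q ^ (N ℕ.+ m)) (ℕ.+-identityʳ N))))

    -- A separate `f` admits summands written with the total inverse, which match the factor
    -- `E k ^ 2` of `term` only up to `_≈_`.
    supercongruence : ∀ N (f : ℕ → Carrier) → (∀ k → f k ≈ term k) →
      let n = suc (N ℕ.+ N) in ∃[ h ] Member h ×
      sum {n} (λ k → f (toℕ k)) - (- 1#) ^ N * p ^ (N ℕ.* suc N)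
        ≈ (1# - a * q ^ n) * (a - q ^ n) * h
    supercongruence N f f≈ = b * Σ< n (g N) , *-closed b∈ (Σ<-closed n (g∈ N)) , (begin
      sum {n} (λ k → f (toℕ k)) - (- 1#) ^ N * p ^ (N ℕ.* suc N)
        ≈⟨ +-cong (trans (sum≈Σ< n f) (Σ<-cong n (λ k → trans (f≈ k) (term≈T k))))
                  -- Slack `d` = N: the sum has 2N + 1 terms, and those of `t N` past k = N vanish.
                  (-‿cong (trans (sym (value≈ N)) (sym (chuVandermonde N N)))) ⟩
      Σ< n T - Σ< n (t N)              ≈⟨ ΣT-reduction N n ⟩
      x N * Σ< n (g N)                 ≈⟨ *-congʳ (x≈modulus N) ⟩
      (1# - a * q ^ n) * (a - q ^ n) * b * Σ< n (g N)    ≈⟨ *-assoc _ _ _ ⟩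
      (1# - a * q ^ n) * (a - q ^ n) * (b * Σ< n (g N))  ∎)
      where n = suc (N ℕ.+ N)

-- Cancellation in an integral domain

module DomainLemmas (D : IntegralDomain) where
  open IntegralDomain D
  open IntegerCoefficients commutativeRing
  open Algebra.Properties.Ring ring using (x≈y⇒x∙y⁻¹≈ε; x∙y⁻¹≈ε⇒x≈y)

  *-cancelʳ : ∀ {x y c} → ¬ (c ≈ 0#) → x * c ≈ y * c → x ≈ y
  *-cancelʳ {x} {y} {c} c≉0 xc≈yc with noZeroDivisors (x - y) c
    (trans (solve 3 (λ x y c → (x :- y) :* c := x :* c :- y :* c) refl x y c) (x≈y⇒x∙y⁻¹≈ε xc≈yc))
  ... | inj₁ x-y≈0 = x∙y⁻¹≈ε⇒x≈y x y x-y≈0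
  ... | inj₂ c≈0   = ⊥-elim (c≉0 c≈0)

  *-≉0 : ∀ {x y} → ¬ (x ≈ 0#) → ¬ (y ≈ 0#) → ¬ (x * y ≈ 0#)
  *-≉0 {x} {y} x≉0 y≉0 xy≈0 with noZeroDivisors x y xy≈0
  ... | inj₁ x≈0 = x≉0 x≈0
  ... | inj₂ y≈0 = y≉0 y≈0

-- The ring of fractions and its localisations

module FractionRing (D : IntegralDomain) where
  private module D = IntegralDomain D
  open DomainLemmas D
  open FractionField D
  open IntegerCoefficients D.commutativeRing
  open Relation.Binary.Reasoning.Setoid D.setoid

  fractionRing : CommutativeRing 0ℓ 0ℓ
  fractionRing = record
    { Carrier = Fraction
    ; _≈_ = _≈ᶠ_
    ; _+_ = _+_
    ; _*_ = _*_
    ; -_ = -_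
    ; 0# = 0#
    ; 1# = 1#
    ; isCommutativeRing = record
      { isRing = record
        { +-isAbelianGroup = record
          { isGroup = record
            { isMonoid = record
              { isSemigroup = record
                { isMagma = record
                  { isEquivalence = record
                    { refl = mk≈ᶠ D.refl
                    ; sym = λ e → mk≈ᶠ (D.sym (cross e))
                    ; trans = ≈ᶠ-trans
                    }
                  ; ∙-cong = +-cong
                  }
                ; assoc = λ x y z → mk≈ᶠ (solve 6 (λ a b c d e f →
                    ((a :* d :+ c :* b) :* f :+ e :* (b :* d)) :* (b :* (d :* f))
                    := (a :* (d :* f) :+ (c :* f :+ e :* d) :* b) :* ((b :* d) :* f)) D.refl
                    (num x) (den x) (num y) (den y) (num z) (den z))
                }
              ; identity = (λ x → mk≈ᶠ (solve 2 (λ a b → (con (+ 0) :* b :+ a :* con (+ 1)) :* b := a :* (con (+ 1) :* b))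
                  D.refl (num x) (den x)))
                         , (λ x → mk≈ᶠ (solve 2 (λ a b → (a :* con (+ 1) :+ con (+ 0) :* b) :* b := a :* (b :* con (+ 1)))
                             D.refl (num x) (den x)))
              }
            ; inverse = (λ x → mk≈ᶠ (solve 2 (λ a b → ((:- a) :* b :+ a :* b) :* con (+ 1) := con (+ 0) :* (b :* b))
                D.refl (num x) (den x)))
                      , (λ x → mk≈ᶠ (solve 2 (λ a b → (a :* b :+ (:- a) :* b) :* con (+ 1) := con (+ 0) :* (b :* b))
                          D.refl (num x) (den x)))
            ; ⁻¹-cong = λ {x} {y} e → mk≈ᶠ (begin
                D.- num x D.* den y
                  ≈⟨ solve 2 (λ a b → (:- a) :* b := :- (a :* b)) D.refl (num x) (den y) ⟩
                D.- (num x D.* den y)   ≈⟨ D.-‿cong (cross e) ⟩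
                D.- (num y D.* den x)
                  ≈⟨ solve 2 (λ a b → :- (a :* b) := (:- a) :* b) D.refl (num y) (den x) ⟩
                D.- num y D.* den x     ∎)
            }
          ; comm = λ x y → mk≈ᶠ (solve 4 (λ a b c d →
              (a :* d :+ c :* b) :* (d :* b) := (c :* b :+ a :* d) :* (b :* d)) D.refl
              (num x) (den x) (num y) (den y))
          }
        ; *-cong = *-cong
        ; *-assoc = λ x y z → mk≈ᶠ (solve 6 (λ a b c d e f →
            ((a :* c) :* e) :* (b :* (d :* f)) := (a :* (c :* e)) :* ((b :* d) :* f)) D.refl
            (num x) (den x) (num y) (den y) (num z) (den z))
        ; *-identity = (λ x → mk≈ᶠ (solve 2 (λ a b → con (+ 1) :* a :* b := a :* (con (+ 1) :* b))
            D.refl (num x) (den x)))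
                     , (λ x → mk≈ᶠ (solve 2 (λ a b → a :* con (+ 1) :* b := a :* (b :* con (+ 1)))
                         D.refl (num x) (den x)))
        ; distrib = (λ x y z → mk≈ᶠ (solve 6 (λ a b c d e f →
                      (a :* (c :* f :+ e :* d)) :* ((b :* d) :* (b :* f))
                      := (a :* c :* (b :* f) :+ a :* e :* (b :* d)) :* (b :* (d :* f))) D.refl
                      (num x) (den x) (num y) (den y) (num z) (den z)))
                  , (λ x y z → mk≈ᶠ (solve 6 (λ a b c d e f →
                      ((c :* f :+ e :* d) :* a) :* ((d :* b) :* (f :* b))
                      := (c :* a :* (f :* b) :+ e :* a :* (d :* b)) :* ((d :* f) :* b)) D.refl
                      (num x) (den x) (num y) (den y) (num z) (den z)))
        }
      ; *-comm = λ x y → mk≈ᶠ (solve 4 (λ a b c d →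
          a :* c :* (d :* b) := c :* a :* (b :* d)) D.refl (num x) (den x) (num y) (den y))
      }
    }
    where
    open RawRing fractionRawRing using (_+_; _*_; -_; 0#; 1#)

    ≈ᶠ-trans : ∀ {x y z} → x ≈ᶠ y → y ≈ᶠ z → x ≈ᶠ z
    ≈ᶠ-trans {x} {y} {z} e f = mk≈ᶠ (*-cancelʳ (den≉0 y) (begin
      num x D.* den z D.* den y
        ≈⟨ solve 3 (λ a b c → a :* b :* c := a :* c :* b) D.refl (num x) (den z) (den y) ⟩
      num x D.* den y D.* den z     ≈⟨ D.*-congʳ (cross e) ⟩
      num y D.* den x D.* den z
        ≈⟨ solve 3 (λ a b c → a :* b :* c := a :* c :* b) D.refl (num y) (den x) (den z) ⟩
      num y D.* den z D.* den x     ≈⟨ D.*-congʳ (cross f) ⟩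
      num z D.* den y D.* den x
        ≈⟨ solve 3 (λ a b c → a :* b :* c := a :* c :* b) D.refl (num z) (den y) (den x) ⟩
      num z D.* den x D.* den y     ∎))

    +-cong : ∀ {x y u v} → x ≈ᶠ y → u ≈ᶠ v → (x + u) ≈ᶠ (y + v)
    +-cong {x} {y} {u} {v} e f = mk≈ᶠ (begin
      (num x D.* den u D.+ num u D.* den x) D.* (den y D.* den v)
        ≈⟨ solve 6 (λ nx dx nu du dy dv → (nx :* du :+ nu :* dx) :* (dy :* dv)
             := (nx :* dy) :* (du :* dv) :+ (nu :* dv) :* (dx :* dy)) D.refl
             (num x) (den x) (num u) (den u) (den y) (den v) ⟩
      (num x D.* den y) D.* (den u D.* den v) D.+ (num u D.* den v) D.* (den x D.* den y)
        ≈⟨ D.+-cong (D.*-congʳ (cross e)) (D.*-congʳ (cross f)) ⟩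
      (num y D.* den x) D.* (den u D.* den v) D.+ (num v D.* den u) D.* (den x D.* den y)
        ≈⟨ solve 6 (λ ny dx nv du dy dv → (ny :* dx) :* (du :* dv) :+ (nv :* du) :* (dx :* dy)
             := (ny :* dv :+ nv :* dy) :* (dx :* du)) D.refl
             (num y) (den x) (num v) (den u) (den y) (den v) ⟩
      (num y D.* den v D.+ num v D.* den y) D.* (den x D.* den u) ∎)

    *-cong : ∀ {x y u v} → x ≈ᶠ y → u ≈ᶠ v → (x * u) ≈ᶠ (y * v)
    *-cong {x} {y} {u} {v} e f = mk≈ᶠ (begin
      (num x D.* num u) D.* (den y D.* den v)
        ≈⟨ solve 4 (λ a b c d → (a :* b) :* (c :* d) := (a :* c) :* (b :* d))
            D.refl (num x) (num u) (den y) (den v) ⟩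
      (num x D.* den y) D.* (num u D.* den v)
        ≈⟨ D.*-cong (cross e) (cross f) ⟩
      (num y D.* den x) D.* (num v D.* den u)
        ≈⟨ solve 4 (λ a b c d → (a :* b) :* (c :* d) := (a :* c) :* (b :* d))
            D.refl (num y) (den x) (num v) (den u) ⟩
      (num y D.* num v) D.* (den x D.* den u) ∎)

  private module F = CommutativeRing fractionRing
  private
    module ED = Algebra.Properties.Semiring.Exp D.semiring
    module EF = Algebra.Properties.Semiring.Exp F.semiring

  embed-* : ∀ x y → embed (x D.* y) F.≈ embed x F.* embed y
  embed-* x y = mk≈ᶠ (D.*-congˡ {x D.* y} (D.*-identityˡ D.1#))

  embed-- : ∀ x y → embed (x D.- y) F.≈ embed x F.- embed y
  embed-- x y = mk≈ᶠ (solve 2 (λ x y → let I = con (+ 1) in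
    (x :- y) :* (I :* I) := (x :* I :+ (:- y) :* I) :* I) D.refl x y)

  embed-^ : ∀ x n → embed (x ED.^ n) F.≈ embed x EF.^ n
  embed-^ x zero    = F.refl
  embed-^ x (suc n) = F.trans (embed-* x (x ED.^ n)) (F.*-congˡ {embed x} (embed-^ x n))

  ⁻¹-inverseʳ : ∀ x → ¬ (num x D.≈ D.0#) → x F.* x ⁻¹ F.≈ F.1#
  ⁻¹-inverseʳ x x≉0 with D.≈0? (num x)
  ... | yes x≈0 = ⊥-elim (x≉0 x≈0)
  ... | no  _   = mk≈ᶠ (solve 2 (λ a b → a :* b :* con (+ 1) := con (+ 1) :* (b :* a)) D.refl (num x) (den x))

  -- The default value of the total inverse cannot occur: a zero numerator of x would make the
  -- product of the two denominators zero.
  x*y≈1⇒x⁻¹≈y : ∀ {x y} → x F.* y F.≈ F.1# → x ⁻¹ F.≈ y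
  x*y≈1⇒x⁻¹≈y {x} {y} xy≈1 with D.≈0? (num x)
  ... | yes x≈0 = ⊥-elim (*-≉0 (den≉0 x) (den≉0 y) (begin
    den x D.* den y                   ≈⟨ D.*-identityˡ _ ⟨
    D.1# D.* (den x D.* den y)        ≈⟨ cross xy≈1 ⟨
    num x D.* num y D.* D.1#          ≈⟨ D.*-congʳ (D.*-congʳ x≈0) ⟩
    D.0# D.* num y D.* D.1#
      ≈⟨ solve 1 (λ y → con (+ 0) :* y :* con (+ 1) := con (+ 0)) D.refl (num y) ⟩
    D.0#                              ∎))
  ... | no  _   = mk≈ᶠ (begin
    den x D.* den y                   ≈⟨ D.*-identityˡ _ ⟨
    D.1# D.* (den x D.* den y)        ≈⟨ cross xy≈1 ⟨
    num x D.* num y D.* D.1#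
      ≈⟨ solve 2 (λ x y → x :* y :* con (+ 1) := y :* x) D.refl (num x) (num y) ⟩
    num y D.* num x                   ∎)

  module Localisation (S : D.Carrier → Set) (1∈S : S D.1#) (*∈S : ∀ {x y} → S x → S y → S (x D.* y)) where

    isSubring : IsSubring fractionRing (λ x → S (den x))
    isSubring = record
      { +-closed = *∈S ; *-closed = *∈S ; -‿closed = λ x∈ → x∈ ; 0-closed = 1∈S ; 1-closed = 1∈S }

    ⁻¹-closed : ∀ x → S (num x) → S (den (x ⁻¹))
    ⁻¹-closed x x∈ with D.≈0? (num x)
    -- The default 0⁻¹ = 0 is written with denominator 1.
    ... | yes _ = 1∈S
    ... | no  _ = x∈

-- Coprimality of monomials and the modulus

module PolynomialCoprimality (D : IntegralDomain) where
  open IntegralDomain D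
  open Polynomial commutativeRing
  private
    D[X] = PolynomialDomain.polynomialDomain D
    module P = IntegralDomain D[X]
    module EP = Algebra.Properties.Semiring.Exp P.semiring
  open IntegerCoefficients commutativeRing
  open DomainLemmas D[X] using (*-cancelʳ)
  open Relation.Binary.Reasoning.Setoid setoid
  private
    module PR = Relation.Binary.Reasoning.Setoid P.setoid
    module PS = IntegerCoefficients polynomialRing
  open Algebra.Definitions.RawSemiring (Semiring.rawSemiring semiring) using (_∣_)
  open Algebra.Definitions.RawSemiring (Semiring.rawSemiring P.semiring) using ()
    renaming (Coprime to Coprimeᴾ)
  open Algebra.Definitions.RawMagma using (_,_)
  open Algebra.Properties.Semiring.Exp semiring using (_^_)

  coeff-⊕ : ∀ p r i → coeff (p ⊕ r) i ≈ coeff p i + coeff r i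
  coeff-⊕ []      r       i       = sym (+-identityˡ _)
  coeff-⊕ (c ∷ p) []      i       = sym (+-identityʳ _)
  coeff-⊕ (c ∷ p) (d ∷ r) zero    = refl
  coeff-⊕ (c ∷ p) (d ∷ r) (suc i) = coeff-⊕ p r i

  coeff-· : ∀ c p i → coeff (c · p) i ≈ c * coeff p i
  coeff-· c []      i       = sym (zeroʳ c)
  coeff-· c (d ∷ p) zero    = refl
  coeff-· c (d ∷ p) (suc i) = coeff-· c p i

  coeff-∷⊛ : ∀ c p r i → coeff ((c ∷ p) ⊛ r) i ≈ c * coeff r i + coeff (0# ∷ p ⊛ r) i
  coeff-∷⊛ c p r i = trans (coeff-⊕ (c · r) (0# ∷ p ⊛ r) i) (+-congʳ (coeff-· c r i))

  coeff₀-⊛ : ∀ p r → coeff (p ⊛ r) 0 ≈ coeff p 0 * coeff r 0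
  coeff₀-⊛ []      r = sym (zeroˡ _)
  coeff₀-⊛ (c ∷ p) r = trans (coeff-∷⊛ c p r 0) (+-identityʳ _)

  coeff-⊛const : ∀ p c i → coeff (p ⊛ const c) i ≈ coeff p i * c
  coeff-⊛const p c i = begin
    coeff (p ⊛ const c) i             ≈⟨ coeff≈ (P.*-comm p (const c)) i ⟩
    coeff (const c ⊛ p) i             ≈⟨ coeff-∷⊛ c [] p i ⟩
    c * coeff p i + coeff (0# ∷ []) i ≈⟨ +-congˡ (zeros i) ⟩
    c * coeff p i + 0#                ≈⟨ solve 2 (λ c x → c :* x :+ con (+ 0) := x :* c) refl c (coeff p i) ⟩
    coeff p i * c                     ∎
    where
    zeros : ∀ i → coeff (0# ∷ []) i ≈ 0#
    zeros zero    = refl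
    zeros (suc i) = refl

  const-cong : ∀ {c d} → c ≈ d → const c ≋ const d
  const-cong e = mk≋ λ { zero → e ; (suc i) → refl }

  const-* : ∀ c d → const (c * d) ≋ const c ⊛ const d
  const-* c d = const-cong (sym (+-identityʳ _))

  const-^ : ∀ c n → const c EP.^ n ≋ const (c ^ n)
  const-^ c zero    = P.refl
  const-^ c (suc n) = P.trans (P.*-congˡ {const c} (const-^ c n)) (P.sym (const-* c _))

  DegreeAtMost : ℕ → Poly → Set
  DegreeAtMost m p = ∀ {i} → m ℕ.< i → coeff p i ≈ 0#

  coeff-top : ∀ {m n} p r → DegreeAtMost m p → DegreeAtMost n r →
              coeff (p ⊛ r) (m ℕ.+ n) ≈ coeff p m * coeff r n
  coeff-top []      r p≤m r≤n = sym (zeroˡ _)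
  coeff-top {zero} {n} (c ∷ p) r p≤m r≤n = begin
    coeff ((c ∷ p) ⊛ r) n                  ≈⟨ coeff-∷⊛ c p r n ⟩
    c * coeff r n + coeff (0# ∷ p ⊛ r) n   ≈⟨ +-congˡ (tail≈0 n) ⟩
    c * coeff r n + 0#                     ≈⟨ +-identityʳ _ ⟩
    c * coeff r n                          ∎
    where
    p≋0 : p ≋ []
    p≋0 = mk≋ λ i → p≤m (s≤s ℕ.z≤n)
    tail≈0 : ∀ i → coeff (0# ∷ p ⊛ r) i ≈ 0#
    tail≈0 zero    = refl
    tail≈0 (suc i) = coeff≈ (P.trans (P.*-congʳ {r} p≋0) (P.zeroˡ r)) i
  coeff-top {suc m} {n} (c ∷ p) r p≤m r≤n = begin
    coeff ((c ∷ p) ⊛ r) (suc (m ℕ.+ n))                      ≈⟨ coeff-∷⊛ c p r _ ⟩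
    c * coeff r (suc (m ℕ.+ n)) + coeff (p ⊛ r) (m ℕ.+ n)    ≈⟨ +-cong (*-congˡ (r≤n (s≤s (ℕ.m≤n+m n m))))
                                                                  (coeff-top p r (λ m<i → p≤m (s≤s m<i)) r≤n) ⟩
    c * 0# + coeff p m * coeff r n
      ≈⟨ solve 2 (λ c x → c :* con (+ 0) :+ x := x) refl c _ ⟩
    coeff p m * coeff r n                                    ∎

  -- Coefficient lists may end in zeros, so the degree is not the length and has to be found with
  -- the zero test.
  zero-or-degree : ∀ p → p ≋ [] ⊎ ∃[ m ] ¬ (coeff p m ≈ 0#) × DegreeAtMost m p
  zero-or-degree [] = inj₁ P.refl
  zero-or-degree (c ∷ p) with zero-or-degree p
  ... | inj₂ (m , lead≉0 , p≤m) = inj₂ (suc m , lead≉0 , λ { {suc i} (s≤s m<i) → p≤m m<i })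
  ... | inj₁ p≋0 with ≈0? c
  ...   | yes c≈0 = inj₁ (mk≋ λ { zero → c≈0 ; (suc i) → coeff≈ p≋0 i })
  ...   | no  c≉0 = inj₂ (0 , c≉0 , λ { {suc i} _ → coeff≈ p≋0 i })

  -- Degrees add over a domain: if z had positive degree, the product would have a nonzero leading
  -- coefficient at a positive index.
  const-factor : ∀ {c} w z → ¬ (c ≈ 0#) → w ⊛ z ≋ const c → z ≋ const (coeff z 0)
  const-factor w z c≉0 wz≋c with zero-or-degree w | zero-or-degree z
  ... | inj₁ w≋0 | _ = ⊥-elim (c≉0 (coeff≈ (P.trans (P.sym wz≋c) (P.trans (P.*-congʳ {z} w≋0) (P.zeroˡ z))) 0))
  ... | inj₂ _ | inj₁ z≋0 = ⊥-elim (c≉0 (coeff≈ (P.trans (P.sym wz≋c) (P.trans (P.*-congˡ {w} z≋0) (P.zeroʳ w))) 0))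
  ... | inj₂ _ | inj₂ (zero , _ , z≤0) = mk≋ λ { zero → refl ; (suc i) → z≤0 (s≤s ℕ.z≤n) }
  ... | inj₂ (m , w≉0 , w≤m) | inj₂ (suc n , z≉0 , z≤n)
    with noZeroDivisors _ _ (trans (sym (coeff-top w z w≤m z≤n))
           (trans (coeff≈ wz≋c (m ℕ.+ suc n)) (reflexive (≡.cong (coeff (const _)) (ℕ.+-suc m n)))))
  ...   | inj₁ w≈0 = ⊥-elim (w≉0 w≈0)
  ...   | inj₂ z≈0 = ⊥-elim (z≉0 z≈0)

  X≉0 : ¬ (X ≋ [])
  X≉0 e = 1≉0 (coeff≈ e 1)

  -- The prime X does not divide z, so each factor X of the product must divide w and can be
  -- cancelled.
  strip-X : ∀ {c} z → ¬ (coeff z 0 ≈ 0#) → ∀ j w → w ⊛ z ≋ const c ⊛ X EP.^ j →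
            ∃[ w′ ] w′ ⊛ z ≋ const c
  strip-X z z₀≉0 zero w e = w , P.trans e (P.*-identityʳ _)
  strip-X {c} z z₀≉0 (suc j) [] e = strip-X z z₀≉0 j [] (*-cancelʳ X≉0
    (P.trans e (PS.solve 3 (λ x y z → x PS.:* (y PS.:* z) PS.:= x PS.:* z PS.:* y)
        P.refl (const c) X (X EP.^ j))))
  strip-X {c} z z₀≉0 (suc j) (d ∷ w) e = strip-X z z₀≉0 j w (*-cancelʳ X≉0 (PR.begin
    w ⊛ z ⊛ X
      PR.≈⟨ PS.solve 3 (λ x y z → x PS.:* y PS.:* z PS.:= z PS.:* x PS.:* y) P.refl w z X ⟩
    X ⊛ w ⊛ z                    PR.≈⟨ P.*-congʳ {z} (P.sym d∷w≋Xw) ⟩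
    (d ∷ w) ⊛ z                  PR.≈⟨ e ⟩
    const c ⊛ (X ⊛ X EP.^ j)
      PR.≈⟨ PS.solve 3 (λ x y z → x PS.:* (y PS.:* z) PS.:= x PS.:* z PS.:* y) P.refl (const c) X (X EP.^ j) ⟩
    const c ⊛ X EP.^ j ⊛ X       PR.∎))
    where
    dz₀≈0 : d * coeff z 0 ≈ 0#
    dz₀≈0 = begin
      d * coeff z 0                          ≈⟨ coeff₀-⊛ (d ∷ w) z ⟨
      coeff ((d ∷ w) ⊛ z) 0                  ≈⟨ coeff≈ e 0 ⟩
      coeff (const c ⊛ (X ⊛ X EP.^ j)) 0     ≈⟨ coeff₀-⊛ (const c) (X ⊛ X EP.^ j) ⟩
      c * coeff (X ⊛ X EP.^ j) 0             ≈⟨ *-congˡ (coeff₀-⊛ X (X EP.^ j)) ⟩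
      c * (0# * coeff (X EP.^ j) 0)
        ≈⟨ solve 2 (λ c x → c :* (con (+ 0) :* x) := con (+ 0)) refl c _ ⟩
      0#                                     ∎
    d≈0 : d ≈ 0#
    d≈0 with noZeroDivisors d (coeff z 0) dz₀≈0
    ... | inj₁ d≈0  = d≈0
    ... | inj₂ z₀≈0 = ⊥-elim (z₀≉0 z₀≈0)
    d∷w≋Xw : d ∷ w ≋ X ⊛ w
    d∷w≋Xw = mk≋ λ
      { zero    → sym (trans (coeff₀-⊛ X w) (trans (zeroˡ _) (sym d≈0)))
      ; (suc i) → sym (trans (coeff-∷⊛ 0# (const 1#) w (suc i))
                      (trans (+-cong (zeroˡ _) (coeff≈ (P.*-identityˡ w) i)) (+-identityˡ _)))
      }

  Monomial : Poly → Set
  Monomial d = ∃[ c ] ∃[ j ] ¬ (c ≈ 0#) × d ≋ const c ⊛ X EP.^ j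

  factor-coeff₀≉0 : ∀ {v z m} → v ⊛ z ≋ m → ¬ (coeff m 0 ≈ 0#) → ¬ (coeff z 0 ≈ 0#)
  factor-coeff₀≉0 {v} {z} {m} vz≋m m₀≉0 z₀≈0 = m₀≉0 (begin
    coeff m 0               ≈⟨ coeff≈ vz≋m 0 ⟨
    coeff (v ⊛ z) 0         ≈⟨ coeff₀-⊛ v z ⟩
    coeff v 0 * coeff z 0   ≈⟨ *-congˡ z₀≈0 ⟩
    coeff v 0 * 0#          ≈⟨ zeroʳ _ ⟩
    0#                      ∎)

  -- A common divisor z has nonzero constant term because m has one. With the powers of X stripped
  -- off, z divides a nonzero constant and is itself constant, so it divides every coefficient of m;
  -- the last hypothesis says that m has trivial content.
  monomial-coprime : ∀ {d m} → Monomial d → ¬ (coeff m 0 ≈ 0#) →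
    (∀ c → (∀ i → c ∣ coeff m i) → c ∣ 1#) → Coprimeᴾ d m
  monomial-coprime {d} {m} (c , j , c≉0 , d≋) m₀≉0 unimodular {z} (w , wz≋d) (v , vz≋m)
    with strip-X z (factor-coeff₀≉0 {v} {z} vz≋m m₀≉0) j w (P.trans wz≋d d≋)
  ... | w′ , w′z≋c = let u , uz₀≈1 = unimodular (coeff z 0) z₀∣m in
    const u , (PR.begin
      const u ⊛ z                   PR.≈⟨ P.*-congˡ {const u} z≋z₀ ⟩
      const u ⊛ const (coeff z 0)   PR.≈⟨ const-* u (coeff z 0) ⟨
      const (u * coeff z 0)         PR.≈⟨ const-cong uz₀≈1 ⟩
      const 1#                      PR.∎)
    where
    z≋z₀ : z ≋ const (coeff z 0)
    z≋z₀ = const-factor w′ z c≉0 w′z≋c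
    z₀∣m : ∀ i → coeff z 0 ∣ coeff m i
    z₀∣m i = coeff v i , (begin
      coeff v i * coeff z 0             ≈⟨ coeff-⊛const v (coeff z 0) i ⟨
      coeff (v ⊛ const (coeff z 0)) i   ≈⟨ coeff≈ (P.*-congˡ {v} z≋z₀) i ⟨
      coeff (v ⊛ z) i                   ≈⟨ coeff≈ vz≋m i ⟩
      coeff m i                         ∎)

  -- `s` will be qⁿ computed in the ring of polynomials in a, which agrees with a constant only up
  -- to `_≋_`.
  modulus-coprime : ∀ {d s t} → Monomial d → ¬ (t ≈ 0#) → s ≋ const t →
                    Coprimeᴾ d ((P.1# P.- X ⊛ s) ⊛ (X P.- s))
  modulus-coprime {d} {s} {t} d-mono t≉0 s≋t =
    monomial-coprime d-mono
      (λ m₀≈0 → t≉0 (begin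
        t                        ≈⟨ -‿involutive t ⟨
        - (- t)                  ≈⟨ -‿cong (coeff≈ m≋ 0) ⟨
        - coeff m 0              ≈⟨ -‿cong m₀≈0 ⟩
        - 0#                     ≈⟨ -0#≈0# ⟩
        0#                       ∎))
      -- The two lowest coefficients -t and 1 + t² already generate the unit ideal, since (1 + t²) +
      -- t·(-t) = 1.
      (λ c c∣m → let k , kc≈ = c∣m 0 ; l , lc≈ = c∣m 1 in
        l + t * k , (begin
          (l + t * k) * c
            ≈⟨ solve 4 (λ l t k c → (l :+ t :* k) :* c := l :* c :+ t :* (k :* c)) refl l t k c ⟩
          l * c + t * (k * c)
            ≈⟨ +-cong (trans lc≈ (coeff≈ m≋ 1)) (*-congˡ (trans kc≈ (coeff≈ m≋ 0))) ⟩
          (1# + t * t) + t * (- t)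
            ≈⟨ solve 1 (λ t → con (+ 1) :+ t :* t :+ t :* (:- t) := con (+ 1)) refl t ⟩
          1#                             ∎))
    where
    open Algebra.Properties.Ring ring using (-‿involutive; -0#≈0#)
    m = (P.1# P.- X ⊛ s) ⊛ (X P.- s)
    m≋ : m ≋ - t ∷ (1# + t * t) ∷ - t ∷ []
    m≋ = P.trans (P.*-cong (P.+-congˡ {P.1#} (P.-‿cong (P.*-congˡ {X} s≋t))) (P.+-congˡ {X} (P.-‿cong s≋t)))
      (mk≋ λ
        { 0 → solve 1 (λ t → (I :- (O :* t :+ O)) :* (O :- t) :+ O := :- t) refl t
        ; 1 → solve 1 (λ t → (I :- (O :* t :+ O)) :* I :+ ((:- (I :* t :+ O)) :* (O :- t) :+ O) := I :+ t :* t)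
            refl t
        ; 2 → solve 1 (λ t → (:- (I :* t :+ O)) :* I := :- t) refl t
        ; (suc (suc (suc i))) → refl
        })
      where
      I = con (+ 1)
      O = con (+ 0)

  1-monomial : Monomial P.1#
  1-monomial = 1# , 0 , 1≉0 , P.sym (P.*-identityˡ P.1#)

  *-monomial : ∀ {d d′} → Monomial d → Monomial d′ → Monomial (d ⊛ d′)
  *-monomial {d} {d′} (c , j , c≉0 , d≋) (c′ , j′ , c′≉0 , d′≋) =
    c * c′ , j ℕ.+ j′ , DomainLemmas.*-≉0 D c≉0 c′≉0 , (PR.begin
      d ⊛ d′                                       PR.≈⟨ P.*-cong d≋ d′≋ ⟩
      const c ⊛ X EP.^ j ⊛ (const c′ ⊛ X EP.^ j′)
        PR.≈⟨ PS.solve 4 (λ a b c d → a PS.:* b PS.:* (c PS.:* d) PS.:= a PS.:* c PS.:* (b PS.:* d))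
            P.refl (const c) (X EP.^ j) (const c′) (X EP.^ j′) ⟩
      const c ⊛ const c′ ⊛ (X EP.^ j ⊛ X EP.^ j′)
        PR.≈⟨ P.*-cong (P.sym (const-* c c′)) (P.sym (EP.^-homo-* X j j′)) ⟩
      const (c * c′) ⊛ X EP.^ (j ℕ.+ j′)            PR.∎)

  X-monomial : Monomial X
  X-monomial = 1# , 1 , 1≉0 , P.sym (P.trans (P.*-identityˡ (X EP.^ 1)) (P.*-identityʳ X))

  const-monomial : ∀ {c d} → ¬ (c ≈ 0#) → d ≋ const c → Monomial d
  const-monomial {c} c≉0 d≋c = c , 0 , c≉0 , P.trans d≋c (P.sym (P.*-identityʳ (const c)))

-- Rational functions in a and q over a coefficient domain

module RationalFunctions (K : IntegralDomain) where

  private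
    module K = IntegralDomain K
    K[q] = PolynomialDomain.polynomialDomain K
    module Kq = IntegralDomain K[q]
    K[a,q] = PolynomialDomain.polynomialDomain K[q]
    module Kaq = IntegralDomain K[a,q]
    module K-poly = PolynomialCoprimality K

  open PolynomialCoprimality K[q]
  open Polynomial Kq.commutativeRing using (X; const; _≋_; coeff≈)
  open FractionField K[a,q]
  open FractionRing K[a,q]
  open CommutativeRing fractionRing
  open QSeries fractionRing
  open Localisation Monomial 1-monomial *-monomial
  open Algebra.Properties.Semiring.Exp semiring
  private
    module Eq = Algebra.Properties.Semiring.Exp Kq.semiring
    module Eaq = Algebra.Properties.Semiring.Exp Kaq.semiring
  open Algebra.Definitions.RawSemiring (Semiring.rawSemiring Kaq.semiring) using (Coprime)
  open Relation.Binary.Reasoning.Setoid setoid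

  X′ : Kq.Carrier
  X′ = Polynomial.X K.commutativeRing

  aᴾ qᴾ : Kaq.Carrier
  aᴾ = X
  qᴾ = const X′

  a q : Carrier
  a = embed aᴾ
  q = embed qᴾ

  qᴾ≉0 : ¬ (qᴾ Kaq.≈ Kaq.0#)
  qᴾ≉0 e = K-poly.X≉0 (coeff≈ e 0)

  X′^≉0 : ∀ n → ¬ (X′ Eq.^ n Kq.≈ Kq.0#)
  X′^≉0 zero    = Kq.1≉0
  X′^≉0 (suc n) = DomainLemmas.*-≉0 K[q] K-poly.X≉0 (X′^≉0 n)

  ρ : ℕ → Kq.Carrier
  ρ i = Kq.1# Kq.- X′ Eq.^ 2 Kq.* (X′ Eq.^ 2) Eq.^ i

  -- Otherwise 1 = Q·Qⁱ, whose right-hand side has constant coefficient 0 in q.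
  ρ≉0 : ∀ i → ¬ (ρ i Kq.≈ Kq.0#)
  ρ≉0 i ρ≈0 = K.1≉0 (K.trans (Polynomial.coeff≈ 1≈ 0)
    (K.trans (K-poly.coeff₀-⊛ (X′ Eq.^ 2) ((X′ Eq.^ 2) Eq.^ i))
    (K.trans (K.*-congʳ (K.trans (K-poly.coeff₀-⊛ X′ (X′ Eq.^ 1)) (K.zeroˡ _))) (K.zeroˡ _))))
    where
    open Algebra.Properties.Ring Kq.ring using (x∙y⁻¹≈ε⇒x≈y)
    1≈ : Kq.1# Kq.≈ X′ Eq.^ 2 Kq.* (X′ Eq.^ 2) Eq.^ i
    1≈ = x∙y⁻¹≈ε⇒x≈y Kq.1# (X′ Eq.^ 2 Kq.* (X′ Eq.^ 2) Eq.^ i) ρ≈0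

  r : ℕ → Kaq.Carrier
  r i = Kaq.1# Kaq.- qᴾ Eaq.^ 2 Kaq.* (qᴾ Eaq.^ 2) Eaq.^ i

  r≋ρ : ∀ i → r i ≋ const (ρ i)
  r≋ρ i = Kaq.+-congˡ {Kaq.1#} (Kaq.-‿cong (Kaq.trans
    (Kaq.*-cong (const-^ X′ 2) (Kaq.trans (Eaq.^-congˡ i (const-^ X′ 2)) (const-^ (X′ Eq.^ 2) i)))
    (Kaq.sym (const-* (X′ Eq.^ 2) ((X′ Eq.^ 2) Eq.^ i)))))

  r≉0 : ∀ i → ¬ (r i Kaq.≈ Kaq.0#)
  r≉0 i r≈0 = ρ≉0 i (coeff≈ (Kaq.trans (Kaq.sym (r≋ρ i)) r≈0) 0)

  embed-r : ∀ i → embed (r i) ≈ 1# - q ^ 2 * (q ^ 2) ^ i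
  embed-r i = begin
    embed (r i)
      ≈⟨ embed-- Kaq.1# (qᴾ Eaq.^ 2 Kaq.* (qᴾ Eaq.^ 2) Eaq.^ i) ⟩
    1# - embed (qᴾ Eaq.^ 2 Kaq.* (qᴾ Eaq.^ 2) Eaq.^ i)
      ≈⟨ +-congˡ {1#} (-‿cong (embed-* (qᴾ Eaq.^ 2) ((qᴾ Eaq.^ 2) Eaq.^ i))) ⟩
    1# - embed (qᴾ Eaq.^ 2) * embed ((qᴾ Eaq.^ 2) Eaq.^ i)
      ≈⟨ +-congˡ {1#} (-‿cong (*-cong (embed-^ qᴾ 2)
           (trans (embed-^ (qᴾ Eaq.^ 2) i) (^-congˡ i (embed-^ qᴾ 2))))) ⟩
    1# - q ^ 2 * (q ^ 2) ^ i ∎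

  e : ℕ → Carrier
  e i = embed (r i) ⁻¹

  e-inverse : ∀ i → e i * (1# - q ^ 2 * (q ^ 2) ^ i) ≈ 1#
  e-inverse i = trans (*-congˡ {e i} (sym (embed-r i)))
    (trans (*-comm (e i) (embed (r i))) (⁻¹-inverseʳ (embed (r i)) (r≉0 i)))

  -- The written denominators of the generators are 1 for a and q, a for a⁻¹, q for q⁻¹ and 1 -
  -- q²ⁱ⁺² for `e i`: all monomials in a over K[q].
  open CongruenceInSubring a (a ⁻¹) q (q ⁻¹)
    (⁻¹-inverseʳ a X≉0) (⁻¹-inverseʳ q qᴾ≉0) e e-inverse
    (λ x → Monomial (den x)) isSubring
    1-monomial (⁻¹-closed a X-monomial) 1-monomial
    (⁻¹-closed q (const-monomial K-poly.X≉0 Kaq.refl))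
    (λ i → ⁻¹-closed (embed (r i)) (const-monomial (ρ≉0 i) (r≋ρ i)))

  modulus : ℕ → Kaq.Carrier
  modulus n = (Kaq.1# Kaq.- aᴾ Kaq.* qᴾ Eaq.^ n) Kaq.* (aᴾ Kaq.- qᴾ Eaq.^ n)

  embed-modulus : ∀ n → embed (modulus n) ≈ (1# - a * q ^ n) * (a - q ^ n)
  embed-modulus n = begin
    embed (modulus n)
      ≈⟨ embed-* (Kaq.1# Kaq.- aᴾ Kaq.* qᴾ Eaq.^ n) (aᴾ Kaq.- qᴾ Eaq.^ n) ⟩
    embed (Kaq.1# Kaq.- aᴾ Kaq.* qᴾ Eaq.^ n) * embed (aᴾ Kaq.- qᴾ Eaq.^ n)
      ≈⟨ *-cong (embed-- Kaq.1# (aᴾ Kaq.* qᴾ Eaq.^ n)) (embed-- aᴾ (qᴾ Eaq.^ n)) ⟩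
    (1# - embed (aᴾ Kaq.* qᴾ Eaq.^ n)) * (a - embed (qᴾ Eaq.^ n))
      ≈⟨ *-cong (+-congˡ {1#} (-‿cong (trans (embed-* aᴾ (qᴾ Eaq.^ n)) (*-congˡ {a} (embed-^ qᴾ n)))))
                (+-congˡ {a} (-‿cong (embed-^ qᴾ n))) ⟩
    (1# - a * q ^ n) * (a - q ^ n) ∎

  qFactorial²⁻¹ : ∀ k → (⟨ q ^ 2 ⨾ q ^ 2 ⟩ k ^ 2) ⁻¹ ≈ E k ^ 2
  qFactorial²⁻¹ k = x*y≈1⇒x⁻¹≈y (^-inverse {⟨ q ^ 2 ⨾ q ^ 2 ⟩ k} {E k} (E-inverse k) 2)

  -- At K = ℚ, unfolding the field operations in order to compare two copies of
  -- a term is infeasible.  The congruence is therefore stated for operations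
  -- that are only propositionally the standard ones.
  record RawFractionField : Set₁ where
    field
      raw : RawRing 0ℓ 0ℓ
    module R = RawRing raw
    field
      inverse : R.Carrier → R.Carrier
      ι       : Kaq.Carrier → R.Carrier
      frac    : (x y : Kaq.Carrier) → ¬ (y Kaq.≈ Kaq.0#) → R.Carrier

  standard : RawFractionField
  standard = record { raw = fractionRawRing ; inverse = _⁻¹ ; ι = embed ; frac = fraction }

  module Terms (𝔽 : RawFractionField) (a q : RawRing.Carrier (RawFractionField.raw 𝔽)) where
    open RawFractionField 𝔽
    open Algebra.Definitions.RawSemiring R.rawSemiring renaming (_^_ to _^ᴿ_; sum to sumᴿ) using ()
    open QShiftedFactorial raw renaming (⟨_⨾_⟩ to ⟨_⨾_⟩ᴿ)

    term-of : ℕ → R.Carrier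
    term-of k = ⟨ a R.* q ⨾ q ^ᴿ 2 ⟩ᴿ k R.* ⟨ q R.* inverse a ⨾ q ^ᴿ 2 ⟩ᴿ k
              R.* inverse (⟨ q ^ᴿ 2 ⨾ q ^ᴿ 2 ⟩ᴿ k ^ᴿ 2)

    difference : (ℕ → R.Carrier) → ℕ → R.Carrier
    difference f N = sumᴿ {suc (N ℕ.+ N)} (λ k → f (toℕ k))
      R.+ R.- ((R.- R.1#) ^ᴿ N R.* inverse q ^ᴿ (N ℕ.* suc N))

  -- Matching on `refl` takes place over the abstract `K`; at ℚ it remains to supply the equations,
  -- the one for `f` pointwise.
  rationalFunctionCongruence : ∀ 𝔽 → 𝔽 ≡ standard → let open RawFractionField 𝔽 in
    ∀ a′ q′ → a′ ≡ ι aᴾ → q′ ≡ ι qᴾ → let open Terms 𝔽 a′ q′ in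
    ∀ N m → m ≡ modulus (suc (N ℕ.+ N)) → ∀ f → (∀ k → f k ≡ term-of k) →
    ∃[ c ] ∃[ d ] ∃[ d≉0 ] Coprime d m × difference f N R.≈ ι m R.* frac c d d≉0
  rationalFunctionCongruence _ ≡.refl _ _ ≡.refl ≡.refl N _ ≡.refl f f≡ =
    let n = suc (N ℕ.+ N)
        h , h∈ , eq = supercongruence N f
          (λ k → trans (reflexive (f≡ k)) (*-congˡ {⟨ a * q ⨾ q ^ 2 ⟩ k * ⟨ q * a ⁻¹ ⨾ q ^ 2 ⟩ k} (qFactorial²⁻¹ k)))
    in num h , den h , den≉0 h , modulus-coprime h∈ (X′^≉0 n) (const-^ X′ n)
         , trans eq (*-congʳ {h} (sym (embed-modulus n)))

-- Arithmetic of the exponents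

-- The quotient j is squeezed by the floor inequalities j·d ≤ i·d < (j + 1)·d, which also cover
-- negative i.
i*d/d≡i : ∀ i d .{{_ : ℕ.NonZero d}} → (i ℤ.* + d) ℤ./ℕ d ≡ i
i*d/d≡i i d@(suc _) = ℤ.≤-antisym
  (ℤ.*-cancelʳ-≤-pos _ _ (+ d) (ℤ.[n/ℕd]*d≤n (i ℤ.* + d) d))
  (ℤ.≤-trans (ℤ.i<j⇒i≤pred[j] i<1+j) (ℤ.≤-reflexive (ℤ.pred-suc j)))
  where
  j = (i ℤ.* + d) ℤ./ℕ d
  i<1+j : i ℤ.< ℤ.suc j
  i<1+j = ℤ.*-cancelʳ-<-nonNeg (+ d) (ℤ.n<s[n/ℕd]*d (i ℤ.* + d) d)

-- The division is exact because 1 - (2N + 1)² = -4N(N + 1).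
exponent : ∀ N → let n = suc (N ℕ.+ N) in
           (1ℤ ℤ.- + n ℤ.* + n) ℤ./ + 4 ≡ ℤ.- + (N ℕ.* suc N)
exponent N = ≡.trans (ℤ.div-pos-is-/ℕ (1ℤ ℤ.- + n ℤ.* + n) 4) (≡.trans (≡.cong (ℤ._/ℕ 4) (begin
  1ℤ ℤ.- + n ℤ.* + n
    ≡⟨ ≡.cong (λ m → 1ℤ ℤ.- m ℤ.* m) (≡.trans (ℤ.pos-+ 1 (N ℕ.+ N)) (≡.cong (ℤ._+_ 1ℤ) (ℤ.pos-+ N N))) ⟩
  1ℤ ℤ.- (1ℤ ℤ.+ (+ N ℤ.+ + N)) ℤ.* (1ℤ ℤ.+ (+ N ℤ.+ + N))  ≡⟨ identity (+ N) ⟩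
  ℤ.- (+ N ℤ.* (1ℤ ℤ.+ + N)) ℤ.* + 4             ≡⟨ ≡.cong (λ m → ℤ.- m ℤ.* + 4) (ℤ.pos-* N (suc N)) ⟨
  ℤ.- + (N ℕ.* suc N) ℤ.* + 4                   ∎)) (i*d/d≡i (ℤ.- + (N ℕ.* suc N)) 4))
  where
  n = suc (N ℕ.+ N)
  open ≡.≡-Reasoning
  identity : ∀ x → 1ℤ ℤ.- (1ℤ ℤ.+ (x ℤ.+ x)) ℤ.* (1ℤ ℤ.+ (x ℤ.+ x)) ≡ ℤ.- (x ℤ.* (1ℤ ℤ.+ x)) ℤ.* + 4
  identity = solve-∀

odd⇒suc-double : ∀ n → n % 2 ≡ 1 → ∃[ N ] n ≡ suc (N ℕ.+ N)
odd⇒suc-double n n%2≡1 = n ℕ./ 2 , (begin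
  n                              ≡⟨ ℕ.m≡m%n+[m/n]*n n 2 ⟩
  n % 2 ℕ.+ n ℕ./ 2 ℕ.* 2        ≡⟨ ≡.cong₂ ℕ._+_ n%2≡1 (ℕ.*-comm (n ℕ./ 2) 2) ⟩
  suc (n ℕ./ 2 ℕ.+ (n ℕ./ 2 ℕ.+ 0))  ≡⟨ ≡.cong (λ m → suc (n ℕ./ 2 ℕ.+ m)) (ℕ.+-identityʳ _) ⟩
  suc (n ℕ./ 2 ℕ.+ n ℕ./ 2)      ∎)
  where open ≡.≡-Reasoning

half-double : ∀ N → (N ℕ.+ N) ℕ./ 2 ≡ N
half-double N = ≡.trans
  (≡.cong (ℕ._/ 2) (≡.trans (≡.cong (N ℕ.+_) (≡.sym (ℕ.+-identityʳ N))) (ℕ.*-comm 2 N)))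
  (ℕ.m*n/n≡m N 2)

-- Passage to the statement over ℚ

open import Defs

⟨⨾⟩-agree : ∀ y p k → ⟨ y ⨾ p ⟩ k ≡ QShiftedFactorial.⟨_⨾_⟩ ℚ⟨a,q⟩ y p k
⟨⨾⟩-agree y p zero    = ≡.refl
⟨⨾⟩-agree y p (suc k) = cong (λ x → x * (1# - y * p ^ k)) (⟨⨾⟩-agree y p k)

^ᶻ-neg : ∀ y m → y ^ᶻ (ℤ.- + m) ≡ (y ⁻¹) ^ m
^ᶻ-neg y zero    = ≡.refl
^ᶻ-neg y (suc m) = ≡.refl

open RationalFunctions ℚ-domain using (RawFractionField; module Terms; rationalFunctionCongruence)

ℚ-fractions : RawFractionField
ℚ-fractions = record { raw = ℚ⟨a,q⟩ ; inverse = _⁻¹ ; ι = embed ; frac = fraction }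

term : ℕ → ℚ⟨a,q⟩-Carrier
term k = (⟨ a * q ⨾ q ^ 2 ⟩ k) * (⟨ q / a ⨾ q ^ 2 ⟩ k) / (⟨ q ^ 2 ⨾ q ^ 2 ⟩ k) ^ 2

term-agree : ∀ k → term k ≡ Terms.term-of ℚ-fractions a q k
term-agree k = cong₂ _/_ (cong₂ _*_ (⟨⨾⟩-agree (a * q) (q ^ 2) k) (⟨⨾⟩-agree (q / a) (q ^ 2) k))
                           (cong (_^ 2) (⟨⨾⟩-agree (q ^ 2) (q ^ 2) k))

difference-agree : ∀ f N → let n = suc (N ℕ.+ N) in
  sum< n f - (- 1#) ^ ((n ∸ 1) ℕ./ 2) * q ^ᶻ ((1ℤ ℤ.- (+ n) ℤ.* (+ n)) ℤ./ (+ 4))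
  ≡ Terms.difference ℚ-fractions a q f N
difference-agree f N = cong₂ (λ m y → sum< (suc (N ℕ.+ N)) f - (- 1#) ^ m * y)
  (half-double N) (≡.trans (cong (q ^ᶻ_) (exponent N)) (^ᶻ-neg q (N ℕ.* suc N)))

-- With `A`, `B` and `P` as variables, the match on `refl` unfolds no concrete rational function.
cofactor⇒≡[mod] : ∀ A B P {Δ} → A - B ≡ Δ →
  ∃[ C ] ∃[ D ] ∃[ D≉0 ] Coprimeᴾ D P × Δ ≈ embed P * fraction C D D≉0 → A ≡ B [mod P ]
cofactor⇒≡[mod] A B P ≡.refl congruence = congruence

odd-congruence : ∀ n → ∃[ N ] n ≡ suc (N ℕ.+ N) →
  ∑[ k < n ] ((⟨ a * q ⨾ q ^ 2 ⟩ k) * (⟨ q / a ⨾ q ^ 2 ⟩ k) / (⟨ q ^ 2 ⨾ q ^ 2 ⟩ k) ^ 2)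
    ≡ (- 1#) ^ ((n ∸ 1) ℕ./ 2) * q ^ᶻ ((1ℤ ℤ.- (+ n) ℤ.* (+ n)) ℤ./ (+ 4))
    [mod (1ᴾ -ᴾ aᴾ *ᴾ qᴾ ^ᴾ n) *ᴾ (aᴾ -ᴾ qᴾ ^ᴾ n) ]
odd-congruence n (N , ≡.refl) = cofactor⇒≡[mod]
  (∑[ k < n ] term k)
  ((- 1#) ^ ((n ∸ 1) ℕ./ 2) * q ^ᶻ ((1ℤ ℤ.- (+ n) ℤ.* (+ n)) ℤ./ (+ 4)))
  ((1ᴾ -ᴾ aᴾ *ᴾ qᴾ ^ᴾ n) *ᴾ (aᴾ -ᴾ qᴾ ^ᴾ n))
  (difference-agree term N)
  (rationalFunctionCongruence ℚ-fractions ≡.refl a q ≡.refl ≡.refl N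
    ((1ᴾ -ᴾ aᴾ *ᴾ qᴾ ^ᴾ n) *ᴾ (aᴾ -ᴾ qᴾ ^ᴾ n)) ≡.refl term term-agree)

theorem1p7 : (n : ℕ) → 0 < n → n % 2 ≡ 1 →
    ∑[ k < n ] ((⟨ a * q ⨾ q ^ 2 ⟩ k) * (⟨ q / a ⨾ q ^ 2 ⟩ k) / (⟨ q ^ 2 ⨾ q ^ 2 ⟩ k) ^ 2)
    ≡ (- 1#) ^ ((n ∸ 1) ℕ./ 2) * q ^ᶻ ((1ℤ ℤ.- (+ n) ℤ.* (+ n)) ℤ./ (+ 4))
    [mod (1ᴾ -ᴾ aᴾ *ᴾ qᴾ ^ᴾ n) *ᴾ (aᴾ -ᴾ qᴾ ^ᴾ n) ]
theorem1p7 n _ n%2≡1 = odd-congruence n (odd⇒suc-double n n%2≡1)
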